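{- Let $\mu,\nu$ be compositions of $n$ with $\nu$ refining $\mu$, and let $\pi\in\mathcal{I}_\mu$. Then \[ \mathfrak{S}^\mu_\pi=\sum_{\tau\in\mathcal{I}_\nu,\ \tau\le_{\mathcal{A}}\pi}\mathfrak{S}^\nu_\tau . \]
   Context: A composition $\mu=(\mu_1,\dots,\mu_k)$ of $n$ has positive integer parts summing to $n$; $\nu$ refines $\mu$ if $\{\sum_{i\le j}\nu_i\}_j\supseteq\{\sum_{i\le j}\mu_i\}_j$. Permutations are in one-line notation; $\mathrm{std}$ is standardization. $\ell$ is Coxeter length, $s_i=(i,i{+}1)$, $e$ the identity, $w_0=n\cdots 21$, and the 0--Hecke product is $w\circ s_i=ws_i$ if $\ell(ws_i)>\ell(w)$, else $w$ (similarly on the left). For $\pi\in S_n$ and $m_r=\mu_1+\dots+\mu_{r-1}$, the $r$th block is $B_r=\pi(m_r{+}1)\cdots\pi(m_r{+}\mu_r)$; $\pi$ is a $\mu$--involution ($\pi\in\mathcal{I}_\mu$) if each $\mathrm{std}(B_r)$ is an involution. For $\pi\in\mathcal{I}_\mu$, $i\in[n-1]$: if values $i,i{+}1$ are in different blocks, $\pi\circ_\mu s_i=s_i\circ\pi$; if they are in the same block $B$, replace $B$ by the word on the same values with standardization $s_r\circ\mathrm{std}(B)\circ s_r$, where $i$ is the $r$th smallest value of $B$. This extends to a right action of the 0--Hecke monoid. $\ell_\mu(\pi)$ is the minimal $p$ with $\pi=e\circ_\mu s_{a_1}\circ_\mu\cdots\circ_\mu s_{a_p}$; $\mathcal{A}_\mu(\pi)=\{w\in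 S_n:e\circ_\mu w=\pi,\ \ell(w)=\ell_\mu(\pi)\}$. Schubert polynomials: with $\partial_i f=(f-s_if)/(x_i-x_{i+1})$ ($s_i$ swapping $x_i,x_{i+1}$), $\mathfrak{S}_{w_0}=x_1^{n-1}x_2^{n-2}\cdots x_{n-1}$ and $\mathfrak{S}_w=\partial_i\mathfrak{S}_{ws_i}$ when $w(i)<w(i{+}1)$. The $\mu$--involution Schubert polynomial is $\mathfrak{S}^\mu_\pi=\sum_{w\in\mathcal{A}_\mu(\pi)}\mathfrak{S}_w$. For $\tau\in\mathcal{I}_\nu$ and $\pi\in\mathcal{I}_\mu$, write $\tau\le_{\mathcal{A}}\pi$ if $\nu$ refines $\mu$ and $\mathcal{A}_\nu(\tau)\subseteq\mathcal{A}_\mu(\pi)$. -}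

module Defs where

open import Data.Bool using (Bool; true; false; _∧_; _∨_; not; if_then_else_; T)
open import Data.Nat using (ℕ; zero; suc; _+_; _*_; _∸_; _≤_; _≡ᵇ_; _<ᵇ_; _≤ᵇ_)
open import Data.Integer using (ℤ; -_) renaming (_+_ to _+ℤ_; 0ℤ to 0ℤ; 1ℤ to 1ℤ)
open import Data.List using (List; []; _∷_; _++_; map; concat; concatMap; length; upTo; filterᵇ)
open import Data.Bool.ListAction using (any; all)
open import Data.Nat.ListAction using (sum)
open import Data.List.Relation.Unary.All using (All)
open import Data.List.Membership.Propositional using (_∈_)
open import Data.List.Relation.Binary.Permutation.Propositional using (_↭_)
open import Data.Vec using (Vec; []; _∷_)
open import Data.Maybe using (Maybe; just; nothing)
open import Relation.Binary.PropositionalEquality using (_≡_)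

Composition : ℕ → List ℕ → Set
Composition n μ = All (λ k → 1 ≤ k) μ Data.Product.× (sum μ ≡ n)
  where import Data.Product

partialSums : List ℕ → List ℕ
partialSums = go 0
  where
  go : ℕ → List ℕ → List ℕ
  go acc []       = []
  go acc (m ∷ ms) = (acc + m) ∷ go (acc + m) ms

Refines : List ℕ → List ℕ → Set
Refines ν μ = ∀ s → s ∈ partialSums μ → s ∈ partialSums ν

-- Permutations in one-line notation, values 1..n, positions 1..n

oneToN : ℕ → List ℕ
oneToN n = map suc (upTo n)

IsPerm : ℕ → List ℕ → Set
IsPerm n w = w ↭ oneToN n

eqL : List ℕ → List ℕ → Bool
eqL []       []       = true
eqL (x ∷ xs) (y ∷ ys) = (x ≡ᵇ y) ∧ eqL xs ys
eqL _        _        = false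

elem : ℕ → List ℕ → Bool
elem x = any (λ y → x ≡ᵇ y)

count : (ℕ → Bool) → List ℕ → ℕ
count p xs = length (filterᵇ p xs)

-- 1-based lookup (default 0)
at : List ℕ → ℕ → ℕ
at []       _             = 0
at (x ∷ xs) zero          = 0
at (x ∷ xs) (suc zero)    = x
at (x ∷ xs) (suc (suc k)) = at xs (suc k)

swap0 : ℕ → List ℕ → List ℕ
swap0 zero    (x ∷ y ∷ xs) = y ∷ x ∷ xs
swap0 (suc k) (x ∷ xs)     = x ∷ swap0 k xs
swap0 _       xs           = xs

-- ordinary products with s_i (i ∈ [n-1], 1-based)
-- w s_i : swap positions i, i+1
rmul : List ℕ → ℕ → List ℕ
rmul w i = swap0 (i ∸ 1) w

lmul : ℕ → List ℕ → List ℕ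
lmul i = map (λ x → if x ≡ᵇ i then suc i else (if x ≡ᵇ suc i then i else x))

-- Coxeter length = number of inversions
len : List ℕ → ℕ
len []       = 0
len (x ∷ xs) = count (λ y → y <ᵇ x) xs + len xs

-- 0-Hecke products  w ∘ s_i  and  s_i ∘ w
hr : List ℕ → ℕ → List ℕ
hr w i = if len w <ᵇ len (rmul w i) then rmul w i else w

hl : ℕ → List ℕ → List ℕ
hl i w = if len w <ᵇ len (lmul i w) then lmul i w else w

std : List ℕ → List ℕ
std B = map (λ x → suc (count (λ y → y <ᵇ x) B)) B

isInvolution : List ℕ → Bool
isInvolution σ = all (λ j → at σ (at σ j) ≡ᵇ j) (oneToN (length σ))

take' : ℕ → List ℕ → List ℕ
take' zero    _        = []
take' (suc k) []       = []
take' (suc k) (x ∷ xs) = x ∷ take' k xs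

drop' : ℕ → List ℕ → List ℕ
drop' zero    xs       = xs
drop' (suc k) []       = []
drop' (suc k) (x ∷ xs) = drop' k xs

blocks : List ℕ → List ℕ → List (List ℕ)
blocks []       π = []
blocks (m ∷ μ)  π = take' m π ∷ blocks μ (drop' m π)

isMuInv : List ℕ → List ℕ → Bool
isMuInv μ π = all (λ B → isInvolution (std B)) (blocks μ π)

valOfRank : List ℕ → ℕ → ℕ
valOfRank B k = go B
  where
  go : List ℕ → ℕ
  go []       = 0
  go (x ∷ xs) = if suc (count (λ y → y <ᵇ x) B) ≡ᵇ k then x else go xs

unstd : List ℕ → List ℕ → List ℕ
unstd B σ = map (valOfRank B) σ

blockStep : ℕ → List ℕ → List ℕ
blockStep i B = unstd B (hr (hl r (std B)) r)
  where r = suc (count (λ y → y <ᵇ i) B)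

bothIn : ℕ → List ℕ → Bool
bothIn i B = elem i B ∧ elem (suc i) B

muAct : List ℕ → List ℕ → ℕ → List ℕ
muAct μ π i =
  if any (bothIn i) bs
  then concat (map (λ B → if bothIn i B then blockStep i B else B) bs)
  else hl i π
  where bs = blocks μ π

actWord : List ℕ → List ℕ → List ℕ → List ℕ
actWord μ π []       = π
actWord μ π (a ∷ as) = actWord μ (muAct μ π a) as

firstDescent : List ℕ → Maybe ℕ
firstDescent w = go 1 w
  where
  go : ℕ → List ℕ → Maybe ℕ
  go i (x ∷ y ∷ xs) = if y <ᵇ x then just i else go (suc i) (y ∷ xs)
  go i _            = nothing

redWordF : ℕ → List ℕ → List ℕ
redWordF zero    w = []
redWordF (suc f) w with firstDescent w
... | nothing = []
... | just i  = redWordF f (rmul w i) ++ (i ∷ [])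

redWord : List ℕ → List ℕ
redWord w = redWordF (suc (len w)) w

-- e ∘_μ w, computed along a reduced word of w (well defined by the paper)
eAct : ℕ → List ℕ → List ℕ → List ℕ
eAct n μ w = actWord μ (oneToN n) (redWord w)

words : ℕ → ℕ → List (List ℕ)
words n zero    = [] ∷ []
words n (suc q) = concatMap (λ a → map (a ∷_) (words n q)) (oneToN (n ∸ 1))

reachableIn : ℕ → List ℕ → List ℕ → ℕ → Bool
reachableIn n μ π q = any (λ a → eqL (actWord μ (oneToN n) a) π) (words n q)

isMuLength : ℕ → List ℕ → List ℕ → ℕ → Bool
isMuLength n μ π p =
  reachableIn n μ π p ∧ not (any (reachableIn n μ π) (upTo p))

insertAll : ℕ → List ℕ → List (List ℕ)
insertAll x []       = (x ∷ []) ∷ []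
insertAll x (y ∷ ys) = (x ∷ y ∷ ys) ∷ map (y ∷_) (insertAll x ys)

permsOf : List ℕ → List (List ℕ)
permsOf []       = [] ∷ []
permsOf (x ∷ xs) = concatMap (insertAll x) (permsOf xs)

perms : ℕ → List (List ℕ)
perms n = permsOf (oneToN n)

inA : ℕ → List ℕ → List ℕ → List ℕ → Bool
inA n μ π w = eqL (eAct n μ w) π ∧ isMuLength n μ π (len w)

-- 𝒜_μ(π) as a (duplicate-free) list
Aset : ℕ → List ℕ → List ℕ → List (List ℕ)
Aset n μ π = filterᵇ (inA n μ π) (perms n)

-- 𝒜_ν(τ) ⊆ 𝒜_μ(π)  (the refinement part of ≤_𝒜 is a hypothesis of the theorem)
Asubset : ℕ → List ℕ → List ℕ → List ℕ → List ℕ → Bool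
Asubset n ν τ μ π = all (λ w → not (inA n ν τ w) ∨ inA n μ π w) (perms n)

-- Polynomials in x₁..x_n with integer coefficients:
-- finite formal sums of terms  c · x^e

Poly : ℕ → Set
Poly n = List (ℤ Data.Product.× Vec ℕ n)
  where import Data.Product

open import Data.Product using (_×_; _,_)

eqV : ∀ {n} → Vec ℕ n → Vec ℕ n → Bool
eqV []       []       = true
eqV (x ∷ xs) (y ∷ ys) = (x ≡ᵇ y) ∧ eqV xs ys

coeff : ∀ {n} → Poly n → Vec ℕ n → ℤ
coeff []             c = 0ℤ
coeff ((z , e) ∷ ts) c = if eqV e c then z +ℤ coeff ts c else coeff ts c

_≈P_ : ∀ {n} → Poly n → Poly n → Set
p ≈P q = ∀ c → coeff p c ≡ coeff q c

sumP : ∀ {n} → List (Poly n) → Poly n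
sumP = concat

-- 1-based exponent access / update of the exponents of x_i, x_{i+1}
getV : ∀ {n} → Vec ℕ n → ℕ → ℕ
getV []       _             = 0
getV (x ∷ xs) zero          = 0
getV (x ∷ xs) (suc zero)    = x
getV (x ∷ xs) (suc (suc k)) = getV xs (suc k)

setV : ∀ {n} → Vec ℕ n → ℕ → ℕ → Vec ℕ n
setV []       _             v = []
setV (x ∷ xs) zero          v = x ∷ xs
setV (x ∷ xs) (suc zero)    v = v ∷ xs
setV (x ∷ xs) (suc (suc k)) v = x ∷ setV xs (suc k) v

-- divided difference ∂_i on a term: the exact quotient
--  (x_i^a x_{i+1}^b − x_i^b x_{i+1}^a)/(x_i − x_{i+1})
--  = Σ_{k<a−b} x_i^{a−1−k} x_{i+1}^{b+k}   (a ≥ b),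
--  = −Σ_{k<b−a} x_i^{b−1−k} x_{i+1}^{a+k}  (a < b)
∂term : ∀ {n} → ℕ → ℤ × Vec ℕ n → Poly n
∂term i (z , e) =
  if b ≤ᵇ a
  then map (λ k → z , setV (setV e i (a ∸ 1 ∸ k)) (suc i) (b + k)) (upTo (a ∸ b))
  else map (λ k → (- z) , setV (setV e i (b ∸ 1 ∸ k)) (suc i) (a + k)) (upTo (b ∸ a))
  where
  a = getV e i
  b = getV e (suc i)

∂ : ∀ {n} → ℕ → Poly n → Poly n
∂ i = concatMap (∂term i)

topExp : (n : ℕ) → Vec ℕ n
topExp zero    = []
topExp (suc m) = m ∷ topExp m

firstAscent : List ℕ → Maybe ℕ
firstAscent w = go 1 w
  where
  go : ℕ → List ℕ → Maybe ℕ
  go i (x ∷ y ∷ xs) = if x <ᵇ y then just i else go (suc i) (y ∷ xs)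
  go i _            = nothing

-- 𝔖_{w₀} = x^{topExp}, and 𝔖_w = ∂_i 𝔖_{w s_i} for (the first) i with w(i) < w(i+1)
schubF : (n : ℕ) → ℕ → List ℕ → Poly n
schubF n zero    w = []
schubF n (suc f) w with firstAscent w
... | nothing = (1ℤ , topExp n) ∷ []
... | just i  = ∂ i (schubF n f (rmul w i))

schub : (n : ℕ) → List ℕ → Poly n
schub n w = schubF n (suc (n * n)) w

invSchub : (n : ℕ) → List ℕ → List ℕ → Poly n
invSchub n μ π = sumP (map (schub n) (Aset n μ π))

{-# OPTIONS --safe #-}

-- Write L i and R k for left and right 0-Hecke multiplication by a simple transposition; they commute.
-- On a μ-involution, ∘_μ s_i is L i when i and i+1 lie in different blocks, and R k after L i when they lie
-- in the same block, k being the place of i once all blocks are sorted. If ν refines μ, it follows by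
-- induction on words that e ∘_μ a is e ∘_ν a multiplied on the right by the element which merges sorted
-- ν-blocks into sorted μ-blocks. That element depends on e ∘_ν a only, so e ∘_ν a = e ∘_ν b implies
-- e ∘_μ a = e ∘_μ b. Hence every w ∈ 𝒜_μ(π) lies in 𝒜_ν(e ∘_ν w) (a shorter word for e ∘_ν w would give
-- a shorter one for π) and 𝒜_ν(e ∘_ν w) ⊆ 𝒜_μ(π): 𝒜_μ(π) is the disjoint union of the 𝒜_ν(τ) inside it.
module Submission where

open import Defs
open import Algebra.Properties.CommutativeSemigroup using (x∙yz≈y∙xz; interchange)
open import Data.Bool using (Bool; true; false; _∧_; _∨_; not; if_then_else_; T)
open import Data.Bool.ListAction using (any)
open import Data.Bool.Properties using (T-≡; T-∧; T-∨; T-not-≡)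
open import Data.Fin as Fin using (Fin; toℕ; fromℕ<; punchOut)
import Data.Fin.Properties as Fin
open import Data.Integer using (ℤ; 0ℤ) renaming (_+_ to _+ℤ_)
import Data.Integer.Properties as ℤ
open import Data.List using (List; []; _∷_; [_]; _++_; map; length; upTo; applyUpTo; concat; concatMap; foldr; filterᵇ)
open import Data.List.Membership.Propositional using (_∈_; _∉_; find)
open import Data.List.Membership.Propositional.Properties
  using (∈-∃++; ∈-map⁺; ∈-map⁻; ∈-upTo⁺; ∈-upTo⁻; ∈-++⁺ˡ; ∈-++⁺ʳ; ∈-++⁻; ∈-concatMap⁺; ∈-concatMap⁻)
open import Data.List.Properties
  using (map-id-local; map-cong-local; map-∘; map-++; length-map; length-upTo; length-++; filter-notAll; foldr-++)
open import Data.List.Relation.Binary.Permutation.Propositional as Perm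
  using (_↭_; ↭-refl; ↭-sym; ↭-trans; ↭-prep; ↭-swap; ↭-reflexive; ↭⇒↭ₛ)
open import Data.List.Relation.Binary.Permutation.Propositional.Properties
  using (∈-resp-↭; shift; ↭-length; ++⁺; drop-mid) renaming (map⁺ to ↭-map⁺)
import Data.List.Relation.Binary.Permutation.Setoid.Properties as SetoidPerm
open import Data.List.Relation.Binary.Pointwise as Pointwise using (Pointwise; []; _∷_)
open import Data.List.Relation.Unary.All as All using (All; []; _∷_)
import Data.List.Relation.Unary.All.Properties as All
open import Data.List.Relation.Unary.AllPairs using ([]; _∷_)
open import Data.List.Relation.Unary.Any as Any using (Any; here; there)
import Data.List.Relation.Unary.Any.Properties as Any
open import Data.List.Relation.Unary.Unique.Propositional using (Unique)
import Data.List.Relation.Unary.Unique.Propositional.Properties as Unique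
open import Data.Maybe using (Maybe; just; nothing)
open import Data.Nat
open import Data.Nat.ListAction using (sum)
open import Data.Nat.ListAction.Properties using (sum-++)
open import Data.Nat.Properties
open import Data.List.Membership.DecPropositional _≟_ using (_∈?_)
open import Data.Product using (_×_; _,_; proj₁; proj₂; ∃; ∃₂)
open import Data.Sum using (_⊎_; inj₁; inj₂)
open import Function using (_∘_; Injective; Equivalence)
open import Relation.Binary.Definitions using (tri<; tri≈; tri>)
open import Relation.Binary.PropositionalEquality
  using (_≡_; _≢_; refl; sym; trans; cong; cong₂; subst; subst₂; ≢-sym; setoid; module ≡-Reasoning)
open import Relation.Nullary using (¬_; Dec; yes; no; contradiction; T?)
open import Relation.Nullary.Decidable using (_×-dec_)

-- Let u be the merging element attached to a word, with places counted from 0. Its one-line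
-- notation sends the place of a value v in the sorted μ-blocks to one more than the place of v in
-- the sorted ν-blocks. Both places depend only on which values lie in which block of e ∘_ν a, hence
-- so does u, although the factorisation of u found along the way may depend on the word. A letter i
-- affects u in one of three ways. If i and i+1 share a ν-block, with ν-place j and μ-place k of i,
-- then u holds the values j+1, j+2 at the adjacent places k, k+1; so left multiplication by the one
-- pair equals right multiplication by the other, the right factor of the ν-action passes through u,
-- and u stays. If they share only a μ-block, the μ-action alone has a right factor: u absorbs it
-- when the ν-block of i comes first, and otherwise u already descends at k and nothing changes. If
-- they lie in different μ-blocks, both actions are left multiplications, which commute with u. In
-- every case the choice can be read off e ∘_ν a, because the μ-blocks of both words hold the same
-- values.

T⇒≡true : ∀ {b} → T b → b ≡ true
T⇒≡true = Equivalence.to T-≡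

≡true⇒T : ∀ {b} → b ≡ true → T b
≡true⇒T = Equivalence.from T-≡

¬T⇒≡false : ∀ {b} → ¬ T b → b ≡ false
¬T⇒≡false {true}  h = contradiction _ h
¬T⇒≡false {false} h = refl

T-iff⇒≡ : ∀ {a b} → (T a → T b) → (T b → T a) → a ≡ b
T-iff⇒≡ {true}  {b} f g = sym (T⇒≡true (f _))
T-iff⇒≡ {false} {b} f g = sym (¬T⇒≡false g)

≡ᵇ-true : ∀ {m n} → m ≡ n → (m ≡ᵇ n) ≡ true
≡ᵇ-true {m} {n} = T⇒≡true ∘ ≡⇒≡ᵇ m n

≡ᵇ-false : ∀ {m n} → m ≢ n → (m ≡ᵇ n) ≡ false
≡ᵇ-false {m} {n} m≢n = ¬T⇒≡false (m≢n ∘ ≡ᵇ⇒≡ m n)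

<ᵇ-true : ∀ {m n} → m < n → (m <ᵇ n) ≡ true
<ᵇ-true = T⇒≡true ∘ <⇒<ᵇ

<ᵇ-false : ∀ {m n} → ¬ (m < n) → (m <ᵇ n) ≡ false
<ᵇ-false {m} {n} m≮n = ¬T⇒≡false (m≮n ∘ <ᵇ⇒< m n)

<ᵇ-true⁻ : ∀ {m n} → (m <ᵇ n) ≡ true → m < n
<ᵇ-true⁻ {m} {n} = <ᵇ⇒< m n ∘ ≡true⇒T

<ᵇ-cong : ∀ {a b c d} → (a < b → c < d) → (c < d → a < b) → (a <ᵇ b) ≡ (c <ᵇ d)
<ᵇ-cong {a} {b} {c} {d} f g = T-iff⇒≡ (<⇒<ᵇ ∘ f ∘ <ᵇ⇒< a b) (<⇒<ᵇ ∘ g ∘ <ᵇ⇒< c d)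

<ᵇ-sucʳ : ∀ {x i} → x ≢ i → (x <ᵇ suc i) ≡ (x <ᵇ i)
<ᵇ-sucʳ x≢i = <ᵇ-cong (λ x<1+i → ≤∧≢⇒< (s≤s⁻¹ x<1+i) x≢i) m<n⇒m<1+n

<ᵇ-sucˡ : ∀ {i y} → y ≢ suc i → (suc i <ᵇ y) ≡ (i <ᵇ y)
<ᵇ-sucˡ y≢1+i = <ᵇ-cong (<-trans (n<1+n _)) (λ i<y → ≤∧≢⇒< i<y (≢-sym y≢1+i))

-- Transposing adjacent values

tr : ℕ → ℕ → ℕ
tr i x = if x ≡ᵇ i then suc i else (if x ≡ᵇ suc i then i else x)

data View (i : ℕ) : ℕ → Set where
  lo    : View i i
  hi    : View i (suc i)
  other : ∀ {x} → x ≢ i → x ≢ suc i → View i x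

view : ∀ i x → View i x
view i x with x ≟ i | x ≟ suc i
... | yes refl | _        = lo
... | no _     | yes refl = hi
... | no x≢i   | no x≢1+i = other x≢i x≢1+i

tr-lo : ∀ i → tr i i ≡ suc i
tr-lo i rewrite ≡ᵇ-true {i} refl = refl

tr-hi : ∀ i → tr i (suc i) ≡ i
tr-hi i rewrite ≡ᵇ-false {suc i} {i} 1+n≢n | ≡ᵇ-true {i} refl = refl

tr-other : ∀ {i x} → x ≢ i → x ≢ suc i → tr i x ≡ x
tr-other x≢i x≢1+i rewrite ≡ᵇ-false x≢i | ≡ᵇ-false x≢1+i = refl

tr-involutive : ∀ i x → tr i (tr i x) ≡ x
tr-involutive i x with view i x
... | lo            rewrite tr-lo i = tr-hi i
... | hi            rewrite tr-hi i = tr-lo i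
... | other x≢i x≢1+i rewrite tr-other x≢i x≢1+i = tr-other x≢i x≢1+i

tr-injective : ∀ i {x y} → tr i x ≡ tr i y → x ≡ y
tr-injective i eq = trans (sym (tr-involutive i _)) (trans (cong (tr i) eq) (tr-involutive i _))

Outside : ℕ → ℕ → Set
Outside i x = x ≢ i × x ≢ suc i

-- No number lies strictly between `i` and `suc i`, so exchanging them alters only the comparison of
-- one with the other, which the hypothesis rules out.
tr-<ᵇ : ∀ i x y → Outside i x ⊎ Outside i y → (tr i x <ᵇ tr i y) ≡ (x <ᵇ y)
tr-<ᵇ i x y h with view i x | view i y
tr-<ᵇ i x y h | other a b | other c d rewrite tr-other a b | tr-other c d = refl
tr-<ᵇ i x y h | other a b | lo rewrite tr-other a b | tr-lo i = <ᵇ-sucʳ a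
tr-<ᵇ i x y h | other a b | hi rewrite tr-other a b | tr-hi i = sym (<ᵇ-sucʳ a)
tr-<ᵇ i x y h | lo | other c d rewrite tr-other c d | tr-lo i = <ᵇ-sucˡ d
tr-<ᵇ i x y h | hi | other c d rewrite tr-other c d | tr-hi i = sym (<ᵇ-sucˡ d)
tr-<ᵇ i x y (inj₁ (a , _)) | lo | lo = contradiction refl a
tr-<ᵇ i x y (inj₂ (a , _)) | lo | lo = contradiction refl a
tr-<ᵇ i x y (inj₁ (a , _)) | lo | hi = contradiction refl a
tr-<ᵇ i x y (inj₂ (_ , a)) | lo | hi = contradiction refl a
tr-<ᵇ i x y (inj₁ (_ , a)) | hi | lo = contradiction refl a
tr-<ᵇ i x y (inj₂ (a , _)) | hi | lo = contradiction refl a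
tr-<ᵇ i x y (inj₁ (_ , a)) | hi | hi = contradiction refl a
tr-<ᵇ i x y (inj₂ (_ , a)) | hi | hi = contradiction refl a

tr-<ᵇ-∉ : ∀ {i y z xs} → i ∉ xs ⊎ suc i ∉ xs → y ∈ xs → z ∈ xs → (tr i y <ᵇ tr i z) ≡ (y <ᵇ z)
tr-<ᵇ-∉ {i} {y} {z} h p q with view i y | view i z
... | other a b | _         = tr-<ᵇ i y z (inj₁ (a , b))
... | _         | other a b = tr-<ᵇ i y z (inj₂ (a , b))
... | lo        | lo        rewrite <ᵇ-false (<-irrefl {tr i i} refl) | <ᵇ-false (<-irrefl {i} refl) = refl
... | hi        | hi        rewrite <ᵇ-false (<-irrefl {tr i (suc i)} refl) | <ᵇ-false (<-irrefl {i} refl) = refl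
tr-<ᵇ-∉ (inj₁ i∉) p q | lo | hi = contradiction p i∉
tr-<ᵇ-∉ (inj₂ j∉) p q | lo | hi = contradiction q j∉
tr-<ᵇ-∉ (inj₁ i∉) p q | hi | lo = contradiction q i∉
tr-<ᵇ-∉ (inj₂ j∉) p q | hi | lo = contradiction p j∉

map-tr-free : ∀ {i xs} → i ∉ xs → suc i ∉ xs → map (tr i) xs ≡ xs
map-tr-free i∉ 1+i∉ = map-id-local (All.tabulate λ x∈ →
  tr-other (λ { refl → i∉ x∈ }) (λ { refl → 1+i∉ x∈ }))

-- Left and right 0-Hecke multiplication on words

-- Positions are counted from 0 in R, while the index of L is a value.
R : ℕ → List ℕ → List ℕ
R zero    (x ∷ y ∷ xs) = if x <ᵇ y then y ∷ x ∷ xs else x ∷ y ∷ xs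
R (suc k) (x ∷ xs)     = x ∷ R k xs
R _       xs           = xs

-- On a word containing both values, this is s_i ∘ w: the length goes up iff i occurs before i+1.
L : ℕ → List ℕ → List ℕ
L i []       = []
L i (x ∷ xs) with view i x
... | lo        = suc i ∷ map (tr i) xs
... | hi        = suc i ∷ xs
... | other _ _ = x ∷ L i xs

L-lo : ∀ i xs → L i (i ∷ xs) ≡ suc i ∷ map (tr i) xs
L-lo i xs = go i refl
  where
  go : ∀ x → x ≡ i → L i (x ∷ xs) ≡ suc i ∷ map (tr i) xs
  go x x≡i with view i x
  ... | lo          = refl
  ... | hi          = contradiction x≡i 1+n≢n
  ... | other x≢i _ = contradiction x≡i x≢i

L-hi : ∀ i xs → L i (suc i ∷ xs) ≡ suc i ∷ xs
L-hi i xs = go (suc i) refl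
  where
  go : ∀ x → x ≡ suc i → L i (x ∷ xs) ≡ suc i ∷ xs
  go x x≡1+i with view i x
  ... | lo            = contradiction (sym x≡1+i) 1+n≢n
  ... | hi            = refl
  ... | other _ x≢1+i = contradiction x≡1+i x≢1+i

L-other : ∀ {i x} xs → x ≢ i → x ≢ suc i → L i (x ∷ xs) ≡ x ∷ L i xs
L-other {i} {x} xs x≢i x≢1+i with view i x
... | lo        = contradiction refl x≢i
... | hi        = contradiction refl x≢1+i
... | other _ _ = refl

Unique⇒∉ : ∀ {x : ℕ} {xs} → Unique (x ∷ xs) → x ∉ xs
Unique⇒∉ (x≢ ∷ _) x∈ = All.lookup x≢ x∈ refl

Unique-tail : ∀ {x : ℕ} {xs} → Unique (x ∷ xs) → Unique xs
Unique-tail (_ ∷ u) = u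

Unique-resp-↭ : ∀ {xs ys : List ℕ} → xs ↭ ys → Unique xs → Unique ys
Unique-resp-↭ p = SetoidPerm.Unique-resp-↭ (setoid ℕ) (↭⇒↭ₛ p)

L-cases : ∀ i w → L i w ≡ w ⊎ L i w ≡ map (tr i) w
L-cases i []       = inj₁ refl
L-cases i (x ∷ xs) with view i x
... | lo          = inj₂ (cong (_∷ map (tr i) xs) (sym (tr-lo i)))
... | hi          = inj₁ refl
... | other a b with L-cases i xs
...   | inj₁ eq = inj₁ (cong (x ∷_) eq)
...   | inj₂ eq = inj₂ (cong₂ _∷_ (sym (tr-other a b)) eq)

L-free : ∀ {i xs} → i ∉ xs → suc i ∉ xs → L i xs ≡ xs
L-free {i} {xs} i∉ 1+i∉ with L-cases i xs
... | inj₁ eq = eq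
... | inj₂ eq = trans eq (map-tr-free i∉ 1+i∉)

L-unique : ∀ i {w} → Unique w → Unique (L i w)
L-unique i {w} u with L-cases i w
... | inj₁ eq rewrite eq = u
... | inj₂ eq rewrite eq = Unique.map⁺ (tr-injective i) u

R-↭ : ∀ k w → R k w ↭ w
R-↭ zero    []           = ↭-refl
R-↭ zero    (x ∷ [])     = ↭-refl
R-↭ zero    (x ∷ y ∷ xs) with x <ᵇ y
... | true  = ↭-swap y x ↭-refl
... | false = ↭-refl
R-↭ (suc k) []           = ↭-refl
R-↭ (suc k) (x ∷ xs)     = ↭-prep x (R-↭ k xs)

∈⇒↭∷ : ∀ {x : ℕ} {xs} → x ∈ xs → ∃ λ ys → xs ↭ x ∷ ys
∈⇒↭∷ {x} x∈ with ys , zs , refl ← ∈-∃++ x∈ = ys ++ zs , shift x ys zs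

map-tr-↭ : ∀ {i w} → Unique w → i ∈ w → suc i ∈ w → map (tr i) w ↭ w
map-tr-↭ {i} {w} u i∈ 1+i∈ with ∈⇒↭∷ i∈
... | ys , p with ∈-resp-↭ p 1+i∈
...   | here eq = contradiction eq 1+n≢n
...   | there q with ∈⇒↭∷ q
...     | zs , p′ = ↭-trans (↭-map⁺ (tr i) w↭) (↭-trans (↭-reflexive swapped) (↭-trans (↭-swap _ _ ↭-refl) (↭-sym w↭)))
  where
  w↭ : w ↭ i ∷ suc i ∷ zs
  w↭ = ↭-trans p (↭-prep i p′)
  u′ : Unique (i ∷ suc i ∷ zs)
  u′ = Unique-resp-↭ w↭ u
  swapped : map (tr i) (i ∷ suc i ∷ zs) ≡ suc i ∷ i ∷ zs
  swapped = cong₂ _∷_ (tr-lo i) (cong₂ _∷_ (tr-hi i)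
    (map-tr-free (Unique⇒∉ u′ ∘ there) (Unique⇒∉ (Unique-tail u′))))

L-↭ : ∀ {i w} → Unique w → i ∈ w → suc i ∈ w → L i w ↭ w
L-↭ {i} {w} u i∈ 1+i∈ with L-cases i w
... | inj₁ eq = ↭-reflexive eq
... | inj₂ eq = ↭-trans (↭-reflexive eq) (map-tr-↭ u i∈ 1+i∈)

-- `R k` sees its word only through one comparison of letters. Applied below to `tr i` on words
-- lacking one of its two values, and to standardization.
R-map : ∀ (f : ℕ → ℕ) k w → (∀ {x y} → x ∈ w → y ∈ w → (f x <ᵇ f y) ≡ (x <ᵇ y)) →
        R k (map f w) ≡ map f (R k w)
R-map f zero    []           h = refl
R-map f zero    (x ∷ [])     h = refl
R-map f zero    (x ∷ y ∷ xs) h rewrite h {x} {y} (here refl) (there (here refl)) with x <ᵇ y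
... | true  = refl
... | false = refl
R-map f (suc k) []           h = refl
R-map f (suc k) (x ∷ xs)     h = cong (f x ∷_) (R-map f k xs (λ p q → h (there p) (there q)))

R-swap : ∀ {x y} xs → (x <ᵇ y) ≡ true → R 0 (x ∷ y ∷ xs) ≡ y ∷ x ∷ xs
R-swap xs eq rewrite eq = refl

R-stay : ∀ {x y} xs → (x <ᵇ y) ≡ false → R 0 (x ∷ y ∷ xs) ≡ x ∷ y ∷ xs
R-stay xs eq rewrite eq = refl

-- This is associativity, (s ∘ w) ∘ t = s ∘ (w ∘ t). The tests made by `L` and `R` interact only
-- when the two places hold exactly `i` and `suc i`, and then both sides end in the descending
-- order. Stated for all words with distinct letters, so that the induction can pass to tails
-- containing only one of the two values.
L-R : ∀ i k w → Unique w → L i (R k w) ≡ R k (L i w)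
L-R i zero    []           u = refl
L-R i (suc k) []           u = refl
L-R i zero    (x ∷ [])     u with view i x
... | lo        = refl
... | hi        = refl
... | other _ _ = refl
L-R i zero    (x ∷ y ∷ xs) u = go (view i x) (view i y) (x <ᵇ y) refl
  where
  tail-free : ∀ {z t zs} → Unique (z ∷ t ∷ zs) → z ∉ zs × t ∉ zs
  tail-free v = Unique⇒∉ v ∘ there , Unique⇒∉ (Unique-tail v)
  go : View i x → View i y → ∀ b → (x <ᵇ y) ≡ b → L i (R 0 (x ∷ y ∷ xs)) ≡ R 0 (L i (x ∷ y ∷ xs))
  go lo lo b eq = contradiction (here refl) (Unique⇒∉ u)
  go hi hi b eq = contradiction (here refl) (Unique⇒∉ u)
  go lo hi b eq
    rewrite <ᵇ-true (n<1+n i) | L-hi i (i ∷ xs) | L-lo i (suc i ∷ xs) | tr-hi i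
          | <ᵇ-false {suc i} {i} (<⇒≯ (n<1+n i))
          | map-tr-free {i} {xs} (proj₁ (tail-free u)) (proj₂ (tail-free u)) = refl
  go hi lo b eq
    rewrite <ᵇ-false {suc i} {i} (<⇒≯ (n<1+n i)) | L-hi i (i ∷ xs)
          | <ᵇ-false {suc i} {i} (<⇒≯ (n<1+n i)) = refl
  go lo (other c d) true eq
    rewrite eq | L-other (i ∷ xs) c d | L-lo i xs | L-lo i (y ∷ xs) | tr-other c d
          | trans (<ᵇ-sucˡ d) eq = refl
  go lo (other c d) false eq
    rewrite eq | L-lo i (y ∷ xs) | tr-other c d | trans (<ᵇ-sucˡ d) eq = refl
  go hi (other c d) true eq
    rewrite eq | L-other (suc i ∷ xs) c d | L-hi i xs | L-hi i (y ∷ xs) | eq = refl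
  go hi (other c d) false eq
    rewrite eq | L-hi i (y ∷ xs) | eq = refl
  go (other a b) lo true eq
    rewrite eq | L-lo i (x ∷ xs) | L-other (i ∷ xs) a b | L-lo i xs | tr-other a b
          | trans (<ᵇ-sucʳ a) eq = refl
  go (other a b) lo false eq
    rewrite eq | L-other (i ∷ xs) a b | L-lo i xs | trans (<ᵇ-sucʳ a) eq = refl
  go (other a b) hi true eq
    rewrite eq | L-hi i (x ∷ xs) | L-other (suc i ∷ xs) a b | L-hi i xs | eq = refl
  go (other a b) hi false eq
    rewrite eq | L-other (suc i ∷ xs) a b | L-hi i xs | eq = refl
  go (other a b) (other c d) true eq
    rewrite eq | L-other (x ∷ xs) c d | L-other xs a b | L-other (y ∷ xs) a b | L-other xs c d | eq = refl
  go (other a b) (other c d) false eq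
    rewrite eq | L-other (y ∷ xs) a b | L-other xs c d | eq = refl
L-R i (suc k) (x ∷ xs) u with view i x
-- The tail no longer contains `i`, so `tr i` preserves all comparisons in it.
... | lo        = cong (suc i ∷_) (sym (R-map (tr i) k xs (tr-<ᵇ-∉ (inj₁ (Unique⇒∉ u)))))
... | hi        = refl
... | other _ _ = cong (x ∷_) (L-R i k xs (Unique-tail u))

-- Counting, inversions and ranks

count-true : ∀ (p : ℕ → Bool) {x} xs → p x ≡ true → count p (x ∷ xs) ≡ suc (count p xs)
count-true p xs eq rewrite eq = refl

count-false : ∀ (p : ℕ → Bool) {x} xs → p x ≡ false → count p (x ∷ xs) ≡ count p xs
count-false p xs eq rewrite eq = refl

count-cong : ∀ {p q : ℕ → Bool} xs → (∀ {x} → x ∈ xs → p x ≡ q x) → count p xs ≡ count q xs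
count-cong []       h = refl
count-cong {p} {q} (x ∷ xs) h rewrite h {x} (here refl) with q x
... | true  = cong suc (count-cong xs (h ∘ there))
... | false = count-cong xs (h ∘ there)

count-mono : ∀ {p q : ℕ → Bool} xs → (∀ {x} → x ∈ xs → T (p x) → T (q x)) → count p xs ≤ count q xs
count-mono []       h = z≤n
count-mono {p} {q} (x ∷ xs) h with p x in px | q x in qx
... | true  | true  = s≤s (count-mono xs (h ∘ there))
... | false | true  = m≤n⇒m≤1+n (count-mono xs (h ∘ there))
... | false | false = count-mono xs (h ∘ there)
... | true  | false = contradiction (h (here refl) (≡true⇒T px)) (λ t → subst T qx t)

count-strict : ∀ {p q : ℕ → Bool} xs → (∀ {x} → x ∈ xs → T (p x) → T (q x)) →
               ∀ {y} → y ∈ xs → p y ≡ false → q y ≡ true → count p xs < count q xs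
count-strict {p} {q} (x ∷ xs) h (here refl) py qy rewrite py | qy = s≤s (count-mono xs (h ∘ there))
count-strict {p} {q} (x ∷ xs) h (there y∈) py qy with p x in px | q x in qx
... | true  | true  = s≤s (count-strict xs (h ∘ there) y∈ py qy)
... | false | true  = m≤n⇒m≤1+n (count-strict xs (h ∘ there) y∈ py qy)
... | false | false = count-strict xs (h ∘ there) y∈ py qy
... | true  | false = contradiction (h (here refl) (≡true⇒T px)) (λ t → subst T qx t)

count-↭ : ∀ (p : ℕ → Bool) {xs ys} → xs ↭ ys → count p xs ≡ count p ys
count-↭ p Perm.refl = refl
count-↭ p (Perm.prep x σ) with p x
... | true  = cong suc (count-↭ p σ)
... | false = count-↭ p σ
count-↭ p (Perm.swap x y σ) with p x in px | p y in py
... | true  | true  rewrite px | py = cong (suc ∘ suc) (count-↭ p σ)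
... | true  | false rewrite px | py = cong suc (count-↭ p σ)
... | false | true  rewrite px | py = cong suc (count-↭ p σ)
... | false | false rewrite px | py = count-↭ p σ
count-↭ p (Perm.trans σ τ) = trans (count-↭ p σ) (count-↭ p τ)

count-map : ∀ (p : ℕ → Bool) (f : ℕ → ℕ) xs → count p (map f xs) ≡ count (p ∘ f) xs
count-map p f []       = refl
count-map p f (x ∷ xs) with p (f x)
... | true  = cong suc (count-map p f xs)
... | false = count-map p f xs

swap0-↭ : ∀ k w → swap0 k w ↭ w
swap0-↭ zero    []           = ↭-refl
swap0-↭ zero    (x ∷ [])     = ↭-refl
swap0-↭ zero    (x ∷ y ∷ xs) = ↭-swap y x ↭-refl
swap0-↭ (suc k) []           = ↭-refl
swap0-↭ (suc k) (x ∷ xs)     = ↭-prep x (swap0-↭ k xs)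

rank : List ℕ → ℕ → ℕ
rank B x = count (λ y → y <ᵇ x) B

-- The inversions of `x` and of `y` with later letters are the same in either order; only the pair
-- itself becomes an inversion.
len-swap-< : ∀ {x y} xs → x < y → len (x ∷ y ∷ xs) < len (y ∷ x ∷ xs)
len-swap-< {x} {y} xs x<y
  rewrite count-false (_<ᵇ x) {y} xs (<ᵇ-false (<⇒≯ x<y))
        | count-true (_<ᵇ y) {x} xs (<ᵇ-true x<y) =
  s≤s (≤-reflexive (x∙yz≈y∙xz +-commutativeSemigroup (rank xs x) (rank xs y) (len xs)))

<ᵇ-+ˡ : ∀ a {b c} → (a + b <ᵇ a + c) ≡ (b <ᵇ c)
<ᵇ-+ˡ zero    = refl
<ᵇ-+ˡ (suc a) = <ᵇ-+ˡ a

if-true : ∀ {A : Set} {b} {x y : A} → b ≡ true → (if b then x else y) ≡ x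
if-true refl = refl

if-false : ∀ {A : Set} {b} {x y : A} → b ≡ false → (if b then x else y) ≡ y
if-false refl = refl

if-∷ : ∀ b {x : ℕ} {xs ys : List ℕ} → (if b then x ∷ xs else x ∷ ys) ≡ x ∷ (if b then xs else ys)
if-∷ true  = refl
if-∷ false = refl

-- A letter in front adds the same number to both lengths, because the words behind it are
-- permutations of each other. This reduces the global length test in `hr` to one local comparison.
swap-if-longer : ∀ k w → (if len w <ᵇ len (swap0 k w) then swap0 k w else w) ≡ R k w
swap-if-longer zero    []           = refl
swap-if-longer zero    (x ∷ [])     rewrite <ᵇ-false (<-irrefl {len (x ∷ [])} refl) = refl
swap-if-longer zero    (x ∷ y ∷ xs) with <-cmp x y
... | tri< x<y _ _ = trans (if-true (<ᵇ-true (len-swap-< xs x<y))) (sym (R-swap xs (<ᵇ-true x<y)))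
... | tri≈ _ refl _ = trans (if-false (<ᵇ-false (<-irrefl {len (x ∷ x ∷ xs)} refl)))
                              (sym (R-stay xs (<ᵇ-false (<-irrefl {x} refl))))
... | tri> x≮y _ y<x = trans (if-false (<ᵇ-false (<⇒≯ (len-swap-< xs y<x))))
                               (sym (R-stay xs (<ᵇ-false x≮y)))
swap-if-longer (suc k) []           = refl
swap-if-longer (suc k) (x ∷ xs)
  rewrite count-↭ (_<ᵇ x) (swap0-↭ k xs) | <ᵇ-+ˡ (rank xs x) {len xs} {len (swap0 k xs)}
        | if-∷ (len xs <ᵇ len (swap0 k xs)) {x} {swap0 k xs} {xs} = cong (x ∷_) (swap-if-longer k xs)

hr≡R : ∀ w i → hr w i ≡ R (i ∸ 1) w
hr≡R w i = swap-if-longer (i ∸ 1) w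

len-map : ∀ (f : ℕ → ℕ) w → (∀ {x y} → x ∈ w → y ∈ w → (f x <ᵇ f y) ≡ (x <ᵇ y)) → len (map f w) ≡ len w
len-map f []       h = refl
len-map f (x ∷ xs) h = cong₂ _+_
  (trans (count-map (_<ᵇ f x) f xs) (count-cong xs (λ y∈ → h (there y∈) (here refl))))
  (len-map f xs (λ p q → h (there p) (there q)))

-- `lmul i` is `map (tr i)` by definition. Letters before the first of `i`, `suc i` keep their
-- inversions, and so does the tail after it, which lacks one of the two values. Hence the length
-- test is decided by the inversions that this first letter has with its tail.
hl≡L : ∀ {i w} → Unique w → i ∈ w → suc i ∈ w → hl i w ≡ L i w
hl≡L {i} {x ∷ xs} u i∈ 1+i∈ with view i x
... | lo = trans (if-true (<ᵇ-true longer)) (cong (_∷ map (tr i) xs) (tr-lo i))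
  where
  1+i∈xs : ∀ {xs} → suc i ∈ i ∷ xs → suc i ∈ xs
  1+i∈xs (here eq) = contradiction eq 1+n≢n
  1+i∈xs (there p) = p
  longer : len (i ∷ xs) < len (lmul i (i ∷ xs))
  longer = +-mono-<-≤
    -- The new inversion comes from `suc i`, which turns into `i` behind the new head `suc i`.
    (≤-trans (count-strict xs imp (1+i∈xs 1+i∈) (<ᵇ-false (<⇒≯ (n<1+n i)))
               (<ᵇ-true (≤-reflexive (trans (cong suc (tr-hi i)) (sym (tr-lo i))))))
             (≤-reflexive (sym (count-map (_<ᵇ tr i i) (tr i) xs))))
    (≤-reflexive (sym (len-map (tr i) xs (tr-<ᵇ-∉ (inj₁ (Unique⇒∉ u))))))
    where
    imp : ∀ {y} → y ∈ xs → T (y <ᵇ i) → T (tr i y <ᵇ tr i i)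
    imp {y} y∈ t = ≡true⇒T (<ᵇ-true (subst (_< tr i i) (sym (tr-other (<⇒≢ y<i) (<⇒≢ (m<n⇒m<1+n y<i))))
      (subst (y <_) (sym (tr-lo i)) (m<n⇒m<1+n y<i))))
      where
      y<i : y < i
      y<i = <ᵇ⇒< y i t
... | hi = if-false (<ᵇ-false shorter)
  where
  imp : ∀ {y} → y ∈ xs → T (tr i y <ᵇ tr i (suc i)) → T (y <ᵇ suc i)
  imp {y} y∈ t with view i y
  ... | lo = ≡true⇒T (<ᵇ-true (n<1+n i))
  ... | hi = contradiction y∈ (Unique⇒∉ u)
  ... | other a b = <⇒<ᵇ (m<n⇒m<1+n (subst (y <_) (tr-hi i) (<ᵇ⇒< y _ (subst (λ z → T (z <ᵇ tr i (suc i))) (tr-other a b) t))))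
  shorter : ¬ (len (suc i ∷ xs) < len (lmul i (suc i ∷ xs)))
  shorter = ≤⇒≯ (+-mono-≤
    (≤-trans (≤-reflexive (count-map (_<ᵇ tr i (suc i)) (tr i) xs)) (count-mono xs imp))
    (≤-reflexive (len-map (tr i) xs (tr-<ᵇ-∉ (inj₂ (Unique⇒∉ u))))))
hl≡L {i} {x ∷ xs} u (here refl) 1+i∈ | other a b = contradiction refl a
hl≡L {i} {x ∷ xs} u (there i∈) (here refl) | other a b = contradiction refl b
hl≡L {i} {x ∷ xs} u (there i∈) (there 1+i∈) | other a b
  rewrite tr-other a b | count-map (_<ᵇ x) (tr i) xs
        | count-cong {λ y → tr i y <ᵇ x} {_<ᵇ x} xs (λ {y} _ → trans (cong (tr i y <ᵇ_) (sym (tr-other a b))) (tr-<ᵇ i y x (inj₂ (a , b))))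
        | <ᵇ-+ˡ (rank xs x) {len xs} {len (map (tr i) xs)}
        | if-∷ (len xs <ᵇ len (map (tr i) xs)) {x} {map (tr i) xs} {xs}
        = cong (x ∷_) (hl≡L (Unique-tail u) i∈ 1+i∈)

rank-mono-≤ : ∀ B {x y} → x ≤ y → rank B x ≤ rank B y
rank-mono-≤ B x≤y = count-mono B λ {z} _ t → <⇒<ᵇ (<-≤-trans (<ᵇ⇒< z _ t) x≤y)

rank-mono-< : ∀ B {x y} → x ∈ B → x < y → rank B x < rank B y
rank-mono-< B {x} {y} x∈ x<y = count-strict B
  (λ {z} _ t → <⇒<ᵇ (<-trans (<ᵇ⇒< z _ t) x<y)) x∈ (<ᵇ-false (<-irrefl {x} refl)) (<ᵇ-true x<y)

rank-<ᵇ : ∀ {B x y} → x ∈ B → y ∈ B → (rank B x <ᵇ rank B y) ≡ (x <ᵇ y)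
rank-<ᵇ {B} {x} {y} x∈ y∈ = <ᵇ-cong {rank B x} {rank B y} {x} {y}
  (λ r → ≰⇒> λ y≤x → <⇒≱ r (rank-mono-≤ B y≤x)) (rank-mono-< B x∈)

rank-injective : ∀ {B x y} → x ∈ B → y ∈ B → rank B x ≡ rank B y → x ≡ y
rank-injective {B} {x} {y} x∈ y∈ eq with <-cmp x y
... | tri< x<y _ _ = contradiction eq (<⇒≢ (rank-mono-< B x∈ x<y))
... | tri≈ _ x≡y _ = x≡y
... | tri> _ _ y<x = contradiction (sym eq) (<⇒≢ (rank-mono-< B y∈ y<x))

rank<length : ∀ {B x} → x ∈ B → rank B x < length B
rank<length {B} {x} x∈ = filter-notAll (λ y → T? (y <ᵇ x)) B
  (Any.map (λ { refl t → <-irrefl refl (<ᵇ⇒< x x t) }) x∈)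

-- The single letter below `suc i` but not below `i` is `i` itself.
rank-suc : ∀ {B i} → Unique B → i ∈ B → rank B (suc i) ≡ suc (rank B i)
rank-suc {B} {i} u i∈ with ∈⇒↭∷ i∈
... | ys , p rewrite count-↭ (_<ᵇ suc i) p | count-↭ (_<ᵇ i) p
  | <ᵇ-true (n<1+n i) | <ᵇ-false (<-irrefl {i} refl) =
  cong suc (count-cong ys λ {y} y∈ → <ᵇ-sucʳ {y} {i} λ { refl → Unique⇒∉ (Unique-resp-↭ p u) y∈ })

-- Local functions of the definitions under global names

search : List ℕ → ℕ → List ℕ → ℕ
search B k []       = 0
search B k (x ∷ xs) = if suc (rank B x) ≡ᵇ k then x else search B k xs

-- The local function of valOfRank has no name: abstracting its three arguments makes the
-- underscore below a pattern unification problem whose solution is that function.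
mutual
  valOfRank≡search : ∀ B k → valOfRank B k ≡ search B k B
  valOfRank≡search []       k = refl
  valOfRank≡search (x ∷ xs) k with suc (rank (x ∷ xs) x) ≡ᵇ k
  ... | true  = refl
  ... | false with x List.∷ xs
  ...   | B = local≡search B k xs

  local≡search : ∀ B k xs → _ ≡ search B k xs
  local≡search B k []       = refl
  local≡search B k (x ∷ xs) with suc (rank B x) ≡ᵇ k
  ... | true  = refl
  ... | false = local≡search B k xs

psums : ℕ → List ℕ → List ℕ
psums a []       = []
psums a (m ∷ ms) = (a + m) ∷ psums (a + m) ms

mutual
  partialSums≡psums : ∀ μ → partialSums μ ≡ psums 0 μ
  -- Abstracting the starting value leaves only variables as arguments, as in `valOfRank≡search`.
  partialSums≡psums μ with 0
  ... | a = local≡psums a μ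

  local≡psums : ∀ a μ → _ ≡ psums a μ
  local≡psums a []      = refl
  local≡psums a (m ∷ μ) = cong ((a + m) ∷_) (local≡psums (a + m) μ)

descent : ℕ → List ℕ → Maybe ℕ
descent i (x ∷ y ∷ xs) = if y <ᵇ x then just i else descent (suc i) (y ∷ xs)
descent i _            = nothing

mutual
  firstDescent≡descent : ∀ w → firstDescent w ≡ descent 1 w
  firstDescent≡descent [] = refl
  firstDescent≡descent (x ∷ []) = refl
  firstDescent≡descent (x ∷ y ∷ xs) with y <ᵇ x
  ... | true = refl
  -- The local function also carries the whole word as a parameter, so the word, the tail and the
  -- counter are abstracted separately.
  ... | false with x List.∷ y List.∷ xs
  ...   | w with y List.∷ xs | 2
  ...     | v | i = local≡descent w i v

  local≡descent : ∀ w i v → _ ≡ descent i v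
  local≡descent w i []           = refl
  local≡descent w i (x ∷ [])     = refl
  local≡descent w i (x ∷ y ∷ xs) =
    cong (if y <ᵇ x then just i else_) (local≡descent w (suc i) (y ∷ xs))

-- The step inside a block, freed from standardization

search-rank : ∀ {B x} xs → (∀ {y} → y ∈ xs → y ∈ B) → x ∈ B → x ∈ xs →
              search B (suc (rank B x)) xs ≡ x
search-rank {B} {x} (y ∷ xs) xs⊆B x∈B x∈ with y ≟ x
... | yes refl = if-true (≡ᵇ-true {suc (rank B x)} refl)
... | no  y≢x  = trans
  (if-false (≡ᵇ-false {suc (rank B y)} {suc (rank B x)}
    (y≢x ∘ rank-injective (xs⊆B (here refl)) x∈B ∘ suc-injective)))
  (search-rank xs (xs⊆B ∘ there) x∈B (tail x∈))
  where
  tail : x ∈ y ∷ xs → x ∈ xs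
  tail (here x≡y) = contradiction (sym x≡y) y≢x
  tail (there p)  = p

valOfRank-rank : ∀ {B x} → x ∈ B → valOfRank B (suc (rank B x)) ≡ x
valOfRank-rank {B} {x} x∈ = trans (valOfRank≡search B _) (search-rank B (λ p → p) x∈ x∈)

map-unique : ∀ (f : ℕ → ℕ) xs → (∀ {x y} → x ∈ xs → y ∈ xs → f x ≡ f y → x ≡ y) →
             Unique xs → Unique (map f xs)
map-unique f []       inj u        = []
map-unique f (x ∷ xs) inj (x≢ ∷ u) =
  All.map⁺ (All.tabulate λ y∈ eq → All.lookup x≢ y∈ (inj (here refl) (there y∈) eq))
  ∷ map-unique f xs (λ p q → inj (there p) (there q)) u

-- Standardization preserves order on `B`, and `i`, `suc i` have consecutive ranks, so it carries
-- `tr i` to `tr (f i)`. Conjugating `std B` and returning to the values of `B` is therefore the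
-- same as acting on `B` directly: by value on the left, by rank on the right.
module Standardize {B : List ℕ} {i : ℕ} (u : Unique B) (i∈ : i ∈ B) (1+i∈ : suc i ∈ B) where
  f : ℕ → ℕ
  f x = suc (rank B x)

  f-injective : ∀ {x y} → x ∈ B → y ∈ B → f x ≡ f y → x ≡ y
  f-injective p q = rank-injective p q ∘ suc-injective

  f-suc : f (suc i) ≡ suc (f i)
  f-suc = cong suc (rank-suc u i∈)

  tr-f : ∀ {x} → x ∈ B → tr (f i) (f x) ≡ f (tr i x)
  tr-f {x} x∈ with view i x
  ... | lo = trans (tr-lo (f i)) (trans (sym f-suc) (cong f (sym (tr-lo i))))
  ... | hi = trans (cong (tr (f i)) f-suc) (trans (tr-hi (f i)) (cong f (sym (tr-hi i))))
  ... | other a b = trans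
    (tr-other (a ∘ f-injective x∈ i∈) (λ eq → b (f-injective x∈ 1+i∈ (trans eq (sym f-suc)))))
    (cong f (sym (tr-other a b)))

  L-f : ∀ xs → (∀ {y} → y ∈ xs → y ∈ B) → L (f i) (map f xs) ≡ map f (L i xs)
  L-f []       xs⊆B = refl
  L-f (x ∷ xs) xs⊆B with view i x
  ... | lo = trans (L-lo (f i) (map f xs)) (cong₂ _∷_ (sym f-suc)
    (trans (sym (map-∘ xs)) (trans (map-cong-local (All.tabulate (tr-f ∘ xs⊆B ∘ there))) (map-∘ xs))))
  ... | hi = subst (λ z → L (f i) (z ∷ map f xs) ≡ z ∷ map f xs) (sym f-suc) (L-hi (f i) (map f xs))
  ... | other a b = trans
    (L-other (map f xs) (a ∘ f-injective x∈ i∈) (λ eq → b (f-injective x∈ 1+i∈ (trans eq (sym f-suc)))))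
    (cong (f x ∷_) (L-f xs (xs⊆B ∘ there)))
    where
    x∈ : x ∈ B
    x∈ = xs⊆B (here refl)

  stepped : List ℕ
  stepped = R (rank B i) (L i B)

  stepped-↭ : stepped ↭ B
  stepped-↭ = ↭-trans (R-↭ (rank B i) (L i B)) (L-↭ u i∈ 1+i∈)

  std-unique : Unique (std B)
  std-unique = map-unique f B f-injective u

  R-L-std : R (rank B i) (L (f i) (std B)) ≡ map f stepped
  R-L-std = trans (cong (R (rank B i)) (L-f B (λ p → p)))
    (R-map f (rank B i) (L i B) λ p q → rank-<ᵇ (∈-resp-↭ (L-↭ u i∈ 1+i∈) p) (∈-resp-↭ (L-↭ u i∈ 1+i∈) q))

  blockStep≡stepped : blockStep i B ≡ stepped
  blockStep≡stepped = begin
    unstd B (hr (hl (f i) (std B)) (f i))       ≡⟨ cong (λ w → unstd B (hr w (f i))) hl-std ⟩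
    unstd B (hr (L (f i) (std B)) (f i))        ≡⟨ cong (unstd B) (hr≡R (L (f i) (std B)) (f i)) ⟩
    unstd B (R (rank B i) (L (f i) (std B)))    ≡⟨ cong (unstd B) R-L-std ⟩
    unstd B (map f stepped)                     ≡⟨ sym (map-∘ stepped) ⟩
    map (valOfRank B ∘ f) stepped               ≡⟨ map-id-local (All.tabulate (valOfRank-rank ∘ ∈-resp-↭ stepped-↭)) ⟩
    stepped ∎
    where
    open ≡-Reasoning
    hl-std : hl (f i) (std B) ≡ L (f i) (std B)
    hl-std = hl≡L std-unique (∈-map⁺ f i∈) (subst (_∈ std B) f-suc (∈-map⁺ f 1+i∈))

  std-stepped : std stepped ≡ R (rank B i) (L (f i) (std B))
  std-stepped = trans (map-cong-local (All.tabulate λ {x} _ → cong suc (count-↭ (_<ᵇ x) stepped-↭))) (sym R-L-std)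

rank-map-tr : ∀ {B i x} → i ∉ B ⊎ suc i ∉ B → x ∈ B → rank (map (tr i) B) (tr i x) ≡ rank B x
rank-map-tr {B} {i} {x} h x∈ = trans (count-map (_<ᵇ tr i x) (tr i) B)
  (count-cong B λ y∈ → tr-<ᵇ-∉ h y∈ x∈)

std-map-tr : ∀ {B i} → i ∉ B ⊎ suc i ∉ B → std (map (tr i) B) ≡ std B
std-map-tr {B} {i} h = trans (sym (map-∘ B))
  (map-cong-local (All.tabulate (cong suc ∘ rank-map-tr h)))

nth : List ℕ → ℕ → ℕ
nth w k = at w (suc k)

-- A lookup outside the word returns 0, so a positive result proves that the place exists. This is
-- why looked-up values are written as successors in what follows.
nth⇒∈ : ∀ w k {x} → nth w k ≡ suc x → suc x ∈ w
nth⇒∈ (y ∷ w) zero    eq = here (sym eq)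
nth⇒∈ (y ∷ w) (suc k) eq = there (nth⇒∈ w k eq)

nth-bound : ∀ w k {x} → nth w k ≡ suc x → k < length w
nth-bound (y ∷ w) zero    eq = s≤s z≤n
nth-bound (y ∷ w) (suc k) eq = s≤s (nth-bound w k eq)

L-nth : ∀ {i} w a b → Unique w → nth w a ≡ suc i → nth w b ≡ suc (suc i) →
        L (suc i) w ≡ (if a <ᵇ b then map (tr (suc i)) w else w)
L-nth (x ∷ w) zero    zero    u p q = contradiction (trans (sym q) p) 1+n≢n
L-nth (x ∷ w) zero    (suc b) u refl q = trans (L-lo _ w) (cong (_∷ map (tr x) w) (sym (tr-lo x)))
L-nth (x ∷ w) (suc a) zero    u p refl = L-hi _ w
L-nth {i} (x ∷ w) (suc a) (suc b) u p q = trans (L-other w x≢i x≢1+i)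
  (trans (cong (x ∷_) (L-nth w a b (Unique-tail u) p q)) (push (a <ᵇ b)))
  where
  x≢i : x ≢ suc i
  x≢i refl = Unique⇒∉ u (nth⇒∈ w a p)
  x≢1+i : x ≢ suc (suc i)
  x≢1+i refl = Unique⇒∉ u (nth⇒∈ w b q)
  push : ∀ c → x ∷ (if c then map (tr (suc i)) w else w) ≡
               (if c then map (tr (suc i)) (x ∷ w) else x ∷ w)
  push true  = cong (_∷ map (tr (suc i)) w) (sym (tr-other x≢i x≢1+i))
  push false = refl

R-nth : ∀ k w → R k w ≡ (if nth w k <ᵇ nth w (suc k) then swap0 k w else w)
R-nth zero    []           = refl
R-nth zero    (x ∷ [])     = refl
R-nth zero    (x ∷ y ∷ xs) = refl
R-nth (suc k) []           = refl
R-nth (suc k) (x ∷ xs)     = trans (cong (x ∷_) (R-nth k xs)) (sym (if-∷ (nth xs k <ᵇ nth xs (suc k))))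

nth-map : ∀ (f : ℕ → ℕ) → f 0 ≡ 0 → ∀ w k → nth (map f w) k ≡ f (nth w k)
nth-map f f0 []      k       = sym f0
nth-map f f0 (x ∷ w) zero    = refl
nth-map f f0 (x ∷ w) (suc k) = nth-map f f0 w k

tr-suc : ∀ i x → tr (suc i) (suc x) ≡ suc (tr i x)
tr-suc i x with x ≡ᵇ i | x ≡ᵇ suc i
... | true  | _     = refl
... | false | true  = refl
... | false | false = refl

nth-swap0 : ∀ k w → suc k < length w → ∀ t → nth (swap0 k w) t ≡ nth w (tr k t)
nth-swap0 zero    (x ∷ y ∷ w) _ zero          = refl
nth-swap0 zero    (x ∷ y ∷ w) _ (suc zero)    = refl
nth-swap0 zero    (x ∷ y ∷ w) _ (suc (suc t)) = refl
nth-swap0 (suc k) (x ∷ w)     _ zero          = refl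
nth-swap0 (suc k) (x ∷ w) (s≤s h) (suc t) rewrite tr-suc k t = nth-swap0 k w h t
nth-swap0 zero    (x ∷ [])    (s≤s ()) _

InRange : ℕ → ℕ → Set
InRange m j = 1 ≤ j × j ≤ m

-- Involutions under 0-Hecke conjugation

-- The two range fields keep iterated lookups away from the default value 0 of `at`.
record Inverse (m : ℕ) (w v : List ℕ) : Set where
  field
    lenʷ : length w ≡ m
    lenᵛ : length v ≡ m
    w-range : ∀ {j} → InRange m j → InRange m (at w j)
    v-range : ∀ {j} → InRange m j → InRange m (at v j)
    v∘w : ∀ {j} → InRange m j → at v (at w j) ≡ j
    w∘v : ∀ {j} → InRange m j → at w (at v j) ≡ j

Inverse-sym : ∀ {m w v} → Inverse m w v → Inverse m v w
Inverse-sym I = record { lenʷ = lenᵛ ; lenᵛ = lenʷ ; w-range = v-range ; v-range = w-range ; v∘w = w∘v ; w∘v = v∘w }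
  where open Inverse I

tr-range : ∀ {m i j} → 1 ≤ i → suc i ≤ m → InRange m j → InRange m (tr i j)
tr-range {m} {i} {j} 1≤i i<m r with view i j
... | lo        rewrite tr-lo i = s≤s z≤n , i<m
... | hi        rewrite tr-hi i = 1≤i , <⇒≤ i<m
... | other a b rewrite tr-other a b = r

-- Inversion turns left into right multiplication. Both sides make the same test: the places in `w`
-- of the values `suc k` and `suc (suc k)` are the two consecutive entries of `v` that `R k`
-- compares.
Inverse-L-R : ∀ {m w v k} → Unique w → suc (suc k) ≤ m → Inverse m w v → Inverse m (L (suc k) w) (R k v)
Inverse-L-R {m} {w} {v} {k} u k<m I = go (at v (suc k)) (at v (suc (suc k))) refl refl
  (v-range r₁) (v-range r₂) (w∘v r₁) (w∘v r₂)
  where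
  open Inverse I
  r₁ : InRange m (suc k)
  r₁ = s≤s z≤n , <⇒≤ k<m
  r₂ : InRange m (suc (suc k))
  r₂ = s≤s z≤n , k<m

  at-swap0 : ∀ {j} → InRange m j → at (swap0 k v) j ≡ at v (tr (suc k) j)
  at-swap0 {suc t} _ = trans (nth-swap0 k v (subst (suc k <_) (sym lenᵛ) k<m) t) (cong (at v) (sym (tr-suc k t)))

  at-map : ∀ {j} → InRange m j → at (map (tr (suc k)) w) j ≡ tr (suc k) (at w j)
  at-map {suc t} _ = nth-map (tr (suc k)) refl w t

  range : ∀ {j} → InRange m j → InRange m (tr (suc k) j)
  range = tr-range (s≤s z≤n) k<m

  swapped : Inverse m (map (tr (suc k)) w) (swap0 k v)
  swapped = record
    { lenʷ = trans (length-map _ w) lenʷ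
    ; lenᵛ = trans (↭-length (swap0-↭ k v)) lenᵛ
    ; w-range = λ r → subst (InRange m) (sym (at-map r)) (range (w-range r))
    ; v-range = λ r → subst (InRange m) (sym (at-swap0 r)) (v-range (range r))
    ; v∘w = λ {j} r → begin
        at (swap0 k v) (at (map (tr (suc k)) w) j)  ≡⟨ cong (at (swap0 k v)) (at-map r) ⟩
        at (swap0 k v) (tr (suc k) (at w j))        ≡⟨ at-swap0 (range (w-range r)) ⟩
        at v (tr (suc k) (tr (suc k) (at w j)))     ≡⟨ cong (at v) (tr-involutive (suc k) (at w j)) ⟩
        at v (at w j)                               ≡⟨ v∘w r ⟩
        j ∎
    ; w∘v = λ {j} r → begin
        at (map (tr (suc k)) w) (at (swap0 k v) j)       ≡⟨ cong (at (map (tr (suc k)) w)) (at-swap0 r) ⟩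
        at (map (tr (suc k)) w) (at v (tr (suc k) j))    ≡⟨ at-map (v-range (range r)) ⟩
        tr (suc k) (at w (at v (tr (suc k) j)))          ≡⟨ cong (tr (suc k)) (w∘v (range r)) ⟩
        tr (suc k) (tr (suc k) j)                        ≡⟨ tr-involutive (suc k) j ⟩
        j ∎
    }
    where open ≡-Reasoning

  go : ∀ a b → at v (suc k) ≡ a → at v (suc (suc k)) ≡ b → InRange m a → InRange m b →
       at w (at v (suc k)) ≡ suc k → at w (at v (suc (suc k))) ≡ suc (suc k) →
       Inverse m (L (suc k) w) (R k v)
  go (suc a) (suc b) va vb _ _ wa wb
    rewrite va | vb | L-nth w a b u wa wb | R-nth k v | va | vb with a <ᵇ b
  ... | true  = swapped
  ... | false = I

∈-oneToN⁺ : ∀ {m j} → InRange m j → j ∈ oneToN m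
∈-oneToN⁺ {m} {suc t} (_ , t<m) = ∈-map⁺ suc (∈-upTo⁺ t<m)

∈-oneToN⁻ : ∀ {m j} → j ∈ oneToN m → InRange m j
∈-oneToN⁻ j∈ with t , t∈ , refl ← ∈-map⁻ suc j∈ = s≤s z≤n , ∈-upTo⁻ t∈

isInvolution⇒Inverse : ∀ {σ} → T (isInvolution σ) → Inverse (length σ) σ σ
isInvolution⇒Inverse {σ} t = record
  { lenʷ = refl ; lenᵛ = refl ; w-range = range ; v-range = range ; v∘w = inv ; w∘v = inv }
  where
  inv : ∀ {j} → InRange (length σ) j → at σ (at σ j) ≡ j
  inv {j} r = ≡ᵇ⇒≡ _ _ (All.lookup (All.all⁺ (λ j → at σ (at σ j) ≡ᵇ j) _ t) (∈-oneToN⁺ r))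
  at-range : ∀ w x {y} → at w x ≡ suc y → InRange (length w) x
  at-range (_ ∷ w) (suc k) eq = s≤s z≤n , nth-bound (_ ∷ w) k eq
  range : ∀ {j} → InRange (length σ) j → InRange (length σ) (at σ j)
  -- Since lookups outside the word give 0, `at σ (at σ j) ≡ j` with `j` positive forces `at σ j`
  -- into the range.
  range {suc _} r = at-range σ _ (inv r)

Inverse⇒isInvolution : ∀ {σ} → Inverse (length σ) σ σ → T (isInvolution σ)
Inverse⇒isInvolution {σ} I = All.all⁻ (λ j → at σ (at σ j) ≡ᵇ j)
  (All.tabulate λ {j} j∈ → ≡⇒≡ᵇ _ _ (Inverse.v∘w I (∈-oneToN⁻ j∈)))

-- From the inverse pair (σ, σ), one use of `Inverse-L-R` gives (s ∘ σ, σ ∘ s). A second use, with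
-- the roles exchanged, gives s ∘ σ ∘ s on both sides, by commutation of `L` and `R`.
R-L-involution : ∀ {σ k} → Unique σ → suc (suc k) ≤ length σ → T (isInvolution σ) →
                 T (isInvolution (R k (L (suc k) σ)))
R-L-involution {σ} {k} u k<m t = Inverse⇒isInvolution (subst (λ m → Inverse m σ′ σ′) (sym (Inverse.lenʷ I₂)) I₂)
  where
  σ′ : List ℕ
  σ′ = R k (L (suc k) σ)
  I₂ : Inverse (length σ) σ′ σ′
  I₂ = subst (λ w → Inverse (length σ) w σ′) (L-R (suc k) k σ u)
    (Inverse-L-R (Unique-resp-↭ (↭-sym (R-↭ k σ)) u) k<m
      (Inverse-sym (Inverse-L-R u k<m (isInvolution⇒Inverse t))))

elem-true : ∀ {x B} → x ∈ B → elem x B ≡ true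
elem-true {x} x∈ = T⇒≡true (Any.any⁺ (x ≡ᵇ_) (Any.map (≡⇒≡ᵇ x _) x∈))

elem-false : ∀ {x B} → x ∉ B → elem x B ≡ false
elem-false {x} {B} x∉ = ¬T⇒≡false (x∉ ∘ Any.map (≡ᵇ⇒≡ x _) ∘ Any.any⁻ (x ≡ᵇ_) B)

Both : ℕ → List ℕ → Set
Both i B = i ∈ B × suc i ∈ B

NotBoth : ℕ → List ℕ → Set
NotBoth i B = i ∉ B ⊎ suc i ∉ B

both? : ∀ i B → Both i B ⊎ NotBoth i B
both? i B with i ∈? B | suc i ∈? B
... | yes p | yes q = inj₁ (p , q)
... | no  p | _     = inj₂ (inj₁ p)
... | _     | no  q = inj₂ (inj₂ q)

bothIn-true : ∀ {i B} → Both i B → bothIn i B ≡ true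
bothIn-true (p , q) rewrite elem-true p = elem-true q

bothIn-false : ∀ {i B} → NotBoth i B → bothIn i B ≡ false
bothIn-false (inj₁ p) rewrite elem-false p = refl
bothIn-false {i} {B} (inj₂ q) rewrite elem-false q with elem i B
... | true  = refl
... | false = refl

-- The action on blocks

_≈ᴮ_ : List (List ℕ) → List (List ℕ) → Set
_≈ᴮ_ = Pointwise _↭_

≈ᴮ-refl : ∀ {bs} → bs ≈ᴮ bs
≈ᴮ-refl = Pointwise.refl ↭-refl

≈ᴮ-sym : ∀ {bs cs} → bs ≈ᴮ cs → cs ≈ᴮ bs
≈ᴮ-sym = Pointwise.symmetric ↭-sym

≈ᴮ-trans : ∀ {bs cs ds} → bs ≈ᴮ cs → cs ≈ᴮ ds → bs ≈ᴮ ds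
≈ᴮ-trans = Pointwise.transitive ↭-trans

≈ᴮ-Both : ∀ {i bs cs} → bs ≈ᴮ cs → Any (Both i) bs → Any (Both i) cs
≈ᴮ-Both (p ∷ ps) (here (a , b)) = here (∈-resp-↭ p a , ∈-resp-↭ p b)
≈ᴮ-Both (p ∷ ps) (there b)      = there (≈ᴮ-Both ps b)

-- The 0-based place of v in the word obtained by sorting every block.
slot : List (List ℕ) → ℕ → ℕ
slot []       v = 0
slot (B ∷ bs) v = if elem v B then rank B v else length B + slot bs v

slot-here : ∀ {v B} bs → v ∈ B → slot (B ∷ bs) v ≡ rank B v
slot-here bs v∈ = if-true (elem-true v∈)

slot-there : ∀ {v B} bs → v ∉ B → slot (B ∷ bs) v ≡ length B + slot bs v
slot-there bs v∉ = if-false (elem-false v∉)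

slot-cong : ∀ {bs cs} → bs ≈ᴮ cs → ∀ v → slot bs v ≡ slot cs v
slot-cong []       v = refl
slot-cong {B ∷ bs} {C ∷ cs} (p ∷ ps) v with v ∈? B
... | yes v∈ = trans (slot-here bs v∈) (trans (count-↭ (_<ᵇ v) p) (sym (slot-here cs (∈-resp-↭ p v∈))))
... | no  v∉ = trans (slot-there bs v∉) (trans (cong₂ _+_ (↭-length p) (slot-cong ps v))
                 (sym (slot-there cs (v∉ ∘ ∈-resp-↭ (↭-sym p)))))

∈-tail : ∀ {v : ℕ} {B xs} → v ∉ B → v ∈ B ++ xs → v ∈ xs
∈-tail {B = B} v∉ v∈ with ∈-++⁻ B v∈
... | inj₁ p = contradiction p v∉
... | inj₂ p = p

slot-bound : ∀ {bs v} → v ∈ concat bs → slot bs v < length (concat bs)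
slot-bound {B ∷ bs} {v} v∈ rewrite length-++ B {concat bs} with v ∈? B
... | yes p rewrite slot-here bs p = <-≤-trans (rank<length p) (m≤m+n (length B) _)
... | no  p rewrite slot-there bs p = +-monoʳ-< (length B) (slot-bound {bs} (∈-tail p v∈))

slot-injective : ∀ {bs v w} → v ∈ concat bs → w ∈ concat bs → slot bs v ≡ slot bs w → v ≡ w
slot-injective {B ∷ bs} {v} {w} v∈ w∈ eq with v ∈? B | w ∈? B
... | yes a | yes b = rank-injective a b (trans (sym (slot-here bs a)) (trans eq (slot-here bs b)))
... | no  a | no  b = slot-injective {bs} (∈-tail a v∈) (∈-tail b w∈)
      (+-cancelˡ-≡ (length B) _ _ (trans (sym (slot-there bs a)) (trans eq (slot-there bs b))))
... | yes a | no  b = contradiction (trans (sym (slot-here bs a)) (trans eq (slot-there bs b)))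
      (<⇒≢ (<-≤-trans (rank<length a) (m≤m+n (length B) _)))
... | no  a | yes b = contradiction (trans (sym (slot-here bs b)) (trans (sym eq) (slot-there bs a)))
      (<⇒≢ (<-≤-trans (rank<length b) (m≤m+n (length B) _)))

-- A block that lacks `i` or `suc i` keeps its internal order under `tr i`, so values are renamed
-- while the sorted places stay put.
slot-map-tr : ∀ {i bs} → ¬ Any (Both i) bs → ∀ v → slot (map (map (tr i)) bs) v ≡ slot bs (tr i v)
slot-map-tr {i} {[]}     nb v = refl
slot-map-tr {i} {B ∷ bs} nb v with both? i B | tr i v ∈? B
... | inj₁ b | _ = contradiction (here b) nb
... | inj₂ n | yes p = trans (slot-here (map (map (tr i)) bs) v∈)
    (trans (cong (rank (map (tr i) B)) (sym (tr-involutive i v))) (trans (rank-map-tr n p) (sym (slot-here bs p))))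
  where
  v∈ : v ∈ map (tr i) B
  v∈ = subst (_∈ map (tr i) B) (tr-involutive i v) (∈-map⁺ (tr i) p)
... | inj₂ n | no  p = trans (slot-there (map (map (tr i)) bs) v∉)
    (trans (cong₂ _+_ (length-map (tr i) B) (slot-map-tr {i} {bs} (nb ∘ there) v)) (sym (slot-there bs p)))
  where
  v∉ : v ∉ map (tr i) B
  v∉ v∈ with x , x∈ , refl ← ∈-map⁻ (tr i) v∈ = p (subst (_∈ B) (sym (tr-involutive i x)) x∈)

Unique-++⁻ : ∀ (xs : List ℕ) {ys} → Unique (xs ++ ys) → Unique xs × Unique ys × (∀ {x} → x ∈ xs → x ∉ ys)
Unique-++⁻ []       u = [] , u , λ ()
Unique-++⁻ (x ∷ xs) (x≢ ∷ u) with Unique-++⁻ xs u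
... | uˡ , uʳ , d = (All.++⁻ˡ xs x≢ ∷ uˡ) , uʳ , λ
  { (here refl) y∈ → All.lookup (All.++⁻ʳ xs x≢) y∈ refl
  ; (there x∈)  y∈ → d x∈ y∈ }

L-++ˡ : ∀ {i} B {xs} → i ∉ xs → suc i ∉ xs → L i (B ++ xs) ≡ L i B ++ xs
L-++ˡ []          a b = L-free a b
L-++ˡ {i} (x ∷ B) {xs} a b with view i x
... | lo        = cong (suc i ∷_) (trans (map-++ (tr i) B xs) (cong (map (tr i) B ++_) (map-tr-free a b)))
... | hi        = refl
... | other _ _ = cong (x ∷_) (L-++ˡ B a b)

L-++ʳ : ∀ {i} B {xs} → i ∉ B → suc i ∉ B → L i (B ++ xs) ≡ B ++ L i xs
L-++ʳ []          a b = refl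
L-++ʳ {i} (x ∷ B) {xs} a b = trans (L-other (B ++ xs) (λ { refl → a (here refl) }) (λ { refl → b (here refl) }))
  (cong (x ∷_) (L-++ʳ B (a ∘ there) (b ∘ there)))

L-++-first : ∀ {i} B {xs} → i ∈ B → suc i ∉ B → L i (B ++ xs) ≡ map (tr i) (B ++ xs)
L-++-first {i} (x ∷ B) {xs} a b with view i x
L-++-first (x ∷ B) {xs} a b | lo = cong (_∷ map (tr x) (B ++ xs)) (sym (tr-lo x))
L-++-first (x ∷ B) a b | hi = contradiction (here refl) b
L-++-first (x ∷ B) (here refl) b | other c d = contradiction refl c
L-++-first (x ∷ B) (there a) b | other c d = cong₂ _∷_ (sym (tr-other c d)) (L-++-first B a (b ∘ there))

L-++-last : ∀ {i} B {xs} → i ∉ B → suc i ∈ B → L i (B ++ xs) ≡ B ++ xs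
L-++-last {i} (x ∷ B) {xs} a b with view i x
L-++-last (x ∷ B) a b | lo = contradiction (here refl) a
L-++-last (x ∷ B) a b | hi = refl
L-++-last (x ∷ B) a (here refl) | other c d = contradiction refl d
L-++-last (x ∷ B) a (there b) | other c d = cong (x ∷_) (L-++-last B (a ∘ there) b)

R-++ˡ : ∀ k B {xs} → suc k < length B → R k (B ++ xs) ≡ R k B ++ xs
R-++ˡ zero    (x ∷ [])     (s≤s ())
R-++ˡ zero    (x ∷ y ∷ B)  _ with x <ᵇ y
... | true  = refl
... | false = refl
R-++ˡ (suc k) (x ∷ B) (s≤s h) = cong (x ∷_) (R-++ˡ k B h)

R-++ʳ : ∀ B k {xs} → R (length B + k) (B ++ xs) ≡ B ++ R k xs
R-++ʳ []      k = refl
R-++ʳ (x ∷ B) k = cong (x ∷_) (R-++ʳ B k)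

blockStepIf : ℕ → List ℕ → List ℕ
blockStepIf i B = if bothIn i B then blockStep i B else B

blockStepIf-no : ∀ {i B} → NotBoth i B → blockStepIf i B ≡ B
blockStepIf-no = if-false ∘ bothIn-false

∉-concat⇒All-NotBoth : ∀ {i} bs → i ∉ concat bs → All (NotBoth i) bs
∉-concat⇒All-NotBoth []       _  = []
∉-concat⇒All-NotBoth (B ∷ bs) i∉ = inj₁ (i∉ ∘ ∈-++⁺ˡ) ∷ ∉-concat⇒All-NotBoth bs (i∉ ∘ ∈-++⁺ʳ B)

Both⇒∈ : ∀ {i bs} → Any (Both i) bs → i ∈ concat bs × suc i ∈ concat bs
Both⇒∈ (here (a , b)) = ∈-++⁺ˡ a , ∈-++⁺ˡ b
Both⇒∈ {bs = B ∷ _} (there p) = ∈-++⁺ʳ B (proj₁ (Both⇒∈ p)) , ∈-++⁺ʳ B (proj₂ (Both⇒∈ p))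

-- `act` presents a step inside one block as multiplications of the whole word. `Lbs` are the blocks
-- after the left multiplication alone, which is all that happens to the finer word when the two
-- values share only a coarse block.
record SameBlock (i : ℕ) (bs : List (List ℕ)) : Set where
  field
    act     : concat (map (blockStepIf i) bs) ≡ R (slot bs i) (L i (concat bs))
    act-≈   : map (blockStepIf i) bs ≈ᴮ bs
    Lbs     : List (List ℕ)
    Lbs-≡   : concat Lbs ≡ L i (concat bs)
    Lbs-≈   : Lbs ≈ᴮ bs
    slot-suc   : slot bs (suc i) ≡ suc (slot bs i)

-- The letters are distinct, so no other block contains `i` or `suc i`. The right multiplication
-- acts at the rank of `i` in its block, shifted by the lengths of the blocks before; that sum is
-- the slot.
sameBlock : ∀ {i bs} → Unique (concat bs) → Any (Both i) bs → SameBlock i bs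
sameBlock {i} {B ∷ bs} u (here (i∈ , 1+i∈)) with Unique-++⁻ B u
... | uB , _ , disj = record
  { act   = begin
      blockStepIf i B ++ concat (map (blockStepIf i) bs)
        ≡⟨ cong₂ _++_ stepB (cong concat rest) ⟩
      R (rank B i) (L i B) ++ concat bs
        ≡⟨ sym (R-++ˡ (rank B i) (L i B) k<) ⟩
      R (rank B i) (L i B ++ concat bs)
        ≡⟨ cong₂ R (sym (slot-here bs i∈)) (sym L≡) ⟩
      R (slot (B ∷ bs) i) (L i (B ++ concat bs)) ∎
  ; act-≈ = subst (_↭ B) (sym stepB) stepped-↭ ∷ subst (_≈ᴮ bs) (sym rest) ≈ᴮ-refl
  ; Lbs   = L i B ∷ bs
  ; Lbs-≡ = sym L≡
  ; Lbs-≈ = L-↭ uB i∈ 1+i∈ ∷ ≈ᴮ-refl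
  ; slot-suc = trans (slot-here bs 1+i∈) (trans (rank-suc uB i∈) (cong suc (sym (slot-here bs i∈))))
  }
  where
  open ≡-Reasoning
  open Standardize uB i∈ 1+i∈
  stepB : blockStepIf i B ≡ R (rank B i) (L i B)
  stepB = trans (if-true (bothIn-true (i∈ , 1+i∈))) blockStep≡stepped
  rest : map (blockStepIf i) bs ≡ bs
  rest = map-id-local (All.map blockStepIf-no (∉-concat⇒All-NotBoth bs (disj i∈)))
  k< : suc (rank B i) < length (L i B)
  k< = subst₂ _<_ (rank-suc uB i∈) (sym (↭-length (L-↭ uB i∈ 1+i∈))) (rank<length 1+i∈)
  L≡ : L i (B ++ concat bs) ≡ L i B ++ concat bs
  L≡ = L-++ˡ B (disj i∈) (disj 1+i∈)
sameBlock {i} {B ∷ bs} u (there b) with Unique-++⁻ B u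
... | _ , ubs , disj = record
  { act   = begin
      blockStepIf i B ++ concat (map (blockStepIf i) bs)
        ≡⟨ cong₂ _++_ (blockStepIf-no (inj₁ i∉)) IH.act ⟩
      B ++ R (slot bs i) (L i (concat bs))
        ≡⟨ sym (R-++ʳ B (slot bs i)) ⟩
      R (length B + slot bs i) (B ++ L i (concat bs))
        ≡⟨ cong₂ R (sym (slot-there bs i∉)) (sym (L-++ʳ B i∉ 1+i∉)) ⟩
      R (slot (B ∷ bs) i) (L i (B ++ concat bs)) ∎
  ; act-≈ = ↭-reflexive (blockStepIf-no (inj₁ i∉)) ∷ IH.act-≈
  ; Lbs   = B ∷ IH.Lbs
  ; Lbs-≡ = trans (cong (B ++_) IH.Lbs-≡) (sym (L-++ʳ B i∉ 1+i∉))
  ; Lbs-≈ = ↭-refl ∷ IH.Lbs-≈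
  ; slot-suc = trans (slot-there bs 1+i∉) (trans (cong (length B +_) IH.slot-suc)
              (trans (+-suc (length B) (slot bs i)) (cong suc (sym (slot-there bs i∉)))))
  }
  where
  open ≡-Reasoning
  module IH = SameBlock (sameBlock ubs b)
  i∉ : i ∉ B
  i∉ p = disj p (proj₁ (Both⇒∈ b))
  1+i∉ : suc i ∉ B
  1+i∉ p = disj p (proj₂ (Both⇒∈ b))

-- Which of the two values occurs first is decided by the order of their blocks, hence by slots and
-- not by the arrangement inside blocks. Two words whose blocks hold the same values thus take the
-- same alternative.
diffBlocks : ∀ {i bs} → i ∈ concat bs → suc i ∈ concat bs → ¬ Any (Both i) bs →
             (slot bs i < slot bs (suc i) × L i (concat bs) ≡ map (tr i) (concat bs)) ⊎
             (slot bs (suc i) < slot bs i × L i (concat bs) ≡ concat bs)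
diffBlocks {i} {B ∷ bs} i∈ 1+i∈ nb with i ∈? B | suc i ∈? B
... | yes a | yes b = contradiction (here (a , b)) nb
... | yes a | no  b rewrite slot-here bs a | slot-there bs b =
  inj₁ (<-≤-trans (rank<length a) (m≤m+n (length B) _) , L-++-first B a b)
... | no  a | yes b rewrite slot-there bs a | slot-here bs b =
  inj₂ (<-≤-trans (rank<length b) (m≤m+n (length B) _) , L-++-last B a b)
... | no  a | no  b rewrite slot-there bs a | slot-there bs b
  with diffBlocks {i} {bs} (∈-tail a i∈) (∈-tail b 1+i∈) (nb ∘ there)
...   | inj₁ (lt , eq) = inj₁ (+-monoʳ-< (length B) lt , trans (L-++ʳ B a b)
          (trans (cong₂ _++_ (sym (map-tr-free a b)) eq) (sym (map-++ (tr i) B (concat bs)))))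
...   | inj₂ (lt , eq) = inj₂ (+-monoʳ-< (length B) lt , trans (L-++ʳ B a b) (cong (B ++_) eq))

InvolutiveBlocks : List (List ℕ) → Set
InvolutiveBlocks = All (λ B → T (isInvolution (std B)))

involutive-step : ∀ {i bs} → Unique (concat bs) → InvolutiveBlocks bs → InvolutiveBlocks (map (blockStepIf i) bs)
involutive-step u [] = []
involutive-step {i} {B ∷ bs} u (t ∷ ts) with Unique-++⁻ B u
... | uB , ubs , _ = first (both? i B) ∷ involutive-step ubs ts
  where
  first : Both i B ⊎ NotBoth i B → T (isInvolution (std (blockStepIf i B)))
  first (inj₂ n) rewrite blockStepIf-no n = t
  first (inj₁ (i∈ , 1+i∈)) = subst (T ∘ isInvolution)
    (sym (trans (cong std (trans (if-true (bothIn-true (i∈ , 1+i∈))) blockStep≡stepped)) std-stepped))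
    (R-L-involution std-unique
      (subst₂ _<_ (rank-suc uB i∈) (sym (length-map _ B)) (rank<length 1+i∈)) t)
    where
    open Standardize uB i∈ 1+i∈

involutive-map-tr : ∀ {i bs} → ¬ Any (Both i) bs → InvolutiveBlocks bs → InvolutiveBlocks (map (map (tr i)) bs)
involutive-map-tr nb [] = []
involutive-map-tr {i} {B ∷ bs} nb (t ∷ ts) with both? i B
... | inj₁ b = contradiction (here b) nb
... | inj₂ n = subst (T ∘ isInvolution) (sym (std-map-tr n)) t ∷ involutive-map-tr (nb ∘ there) ts

-- Cutting a word into blocks

take'++drop' : ∀ m π → take' m π ++ drop' m π ≡ π
take'++drop' zero    π       = refl
take'++drop' (suc m) []      = refl
take'++drop' (suc m) (x ∷ π) = cong (x ∷_) (take'++drop' m π)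

length-take' : ∀ m π → m ≤ length π → length (take' m π) ≡ m
length-take' zero    π       _       = refl
length-take' (suc m) (x ∷ π) (s≤s h) = cong suc (length-take' m π h)

length-drop' : ∀ m π → length (drop' m π) ≡ length π ∸ m
length-drop' zero    π       = refl
length-drop' (suc m) []      = refl
length-drop' (suc m) (x ∷ π) = length-drop' m π

take'-++ : ∀ (xs : List ℕ) {ys} → take' (length xs) (xs ++ ys) ≡ xs
take'-++ []       = refl
take'-++ (x ∷ xs) = cong (x ∷_) (take'-++ xs)

drop'-++ : ∀ (xs : List ℕ) {ys} → drop' (length xs) (xs ++ ys) ≡ ys
drop'-++ []       = refl
drop'-++ (x ∷ xs) = drop'-++ xs

take'-map : ∀ (f : ℕ → ℕ) m π → take' m (map f π) ≡ map f (take' m π)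
take'-map f zero    π       = refl
take'-map f (suc m) []      = refl
take'-map f (suc m) (x ∷ π) = cong (f x ∷_) (take'-map f m π)

drop'-map : ∀ (f : ℕ → ℕ) m π → drop' m (map f π) ≡ map f (drop' m π)
drop'-map f zero    π       = refl
drop'-map f (suc m) []      = refl
drop'-map f (suc m) (x ∷ π) = drop'-map f m π

blocks-map : ∀ (f : ℕ → ℕ) μ π → blocks μ (map f π) ≡ map (map f) (blocks μ π)
blocks-map f []      π = refl
blocks-map f (m ∷ μ) π = cong₂ _∷_ (take'-map f m π)
  (trans (cong (blocks μ) (drop'-map f m π)) (blocks-map f μ (drop' m π)))

sum-drop' : ∀ {m μ} π → m + sum μ ≡ length π → sum μ ≡ length (drop' m π)
sum-drop' {m} {μ} π eq = sym (trans (length-drop' m π) (trans (cong (_∸ m) (sym eq)) (m+n∸m≡n m (sum μ))))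

head≤length : ∀ {m μ} {π : List ℕ} → m + sum μ ≡ length π → m ≤ length π
head≤length {m} {μ} eq = subst (m ≤_) eq (m≤m+n m (sum μ))

concat-blocks : ∀ {μ} π → sum μ ≡ length π → concat (blocks μ π) ≡ π
concat-blocks {[]}    []      eq = refl
concat-blocks {m ∷ μ} π       eq = trans
  (cong (take' m π ++_) (concat-blocks {μ} (drop' m π) (sum-drop' {m} {μ} π eq))) (take'++drop' m π)

blocks-concat : ∀ {μ bs} π → sum μ ≡ length π → bs ≈ᴮ blocks μ π → blocks μ (concat bs) ≡ bs
blocks-concat {[]}    π eq [] = refl
blocks-concat {m ∷ μ} {B ∷ bs} π eq (p ∷ ps) = cong₂ _∷_
  (trans (cong (λ k → take' k (B ++ concat bs)) (sym |B|)) (take'-++ B))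
  (trans (cong (blocks μ) (trans (cong (λ k → drop' k (B ++ concat bs)) (sym |B|)) (drop'-++ B)))
         (blocks-concat {μ} (drop' m π) (sum-drop' {m} {μ} π eq) ps))
  where
  |B| : length B ≡ m
  |B| = trans (↭-length p) (length-take' m π (head≤length {m} {μ} {π} eq))

-- Refinement of compositions

data Coarsening : List ℕ → List ℕ → Set where
  []    : Coarsening [] []
  merge : ∀ ν₁ {ν μ} → Coarsening ν μ → Coarsening (ν₁ ++ ν) (sum ν₁ ∷ μ)

psums-++ : ∀ a ν₁ ν₂ → psums a (ν₁ ++ ν₂) ≡ psums a ν₁ ++ psums (a + sum ν₁) ν₂
psums-++ a []       ν₂ = cong (λ b → psums b ν₂) (sym (+-identityʳ a))
psums-++ a (m ∷ ν₁) ν₂ = cong ((a + m) ∷_)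
  (trans (psums-++ (a + m) ν₁ ν₂) (cong (λ b → psums (a + m) ν₁ ++ psums b ν₂) (+-assoc a m (sum ν₁))))

psums-split : ∀ {s} a ν → s ∈ psums a ν → ∃₂ λ ν₁ ν₂ → ν ≡ ν₁ ++ ν₂ × a + sum ν₁ ≡ s
psums-split a (m ∷ ν) (here refl) = [ m ] , ν , refl , cong (a +_) (+-identityʳ m)
psums-split a (m ∷ ν) (there s∈) with ν₁ , ν₂ , refl , refl ← psums-split (a + m) ν s∈ =
  m ∷ ν₁ , ν₂ , refl , sym (+-assoc a m (sum ν₁))

psums-≤ : ∀ {s} a ν → s ∈ psums a ν → s ≤ a + sum ν
psums-≤ a (m ∷ ν) (here refl) = +-monoʳ-≤ a (m≤m+n m (sum ν))
psums-≤ a (m ∷ ν) (there s∈) = ≤-trans (psums-≤ (a + m) ν s∈) (≤-reflexive (+-assoc a m (sum ν)))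

psums-> : ∀ {s} a {ν} → All (1 ≤_) ν → s ∈ psums a ν → a < s
psums-> a (1≤m ∷ ps) (here refl) = m<m+n a 1≤m
psums-> a {m ∷ ν} (1≤m ∷ ps) (there s∈) = ≤-<-trans (m≤m+n a m) (psums-> (a + m) ps s∈)

-- The end `a + m` of the first part of `μ` is a partial sum of `ν`, and `ν` is cut there. By
-- positivity the later partial sums of `μ` exceed `a + m`, which those of the first piece of `ν` do
-- not, so they all come from the second piece.
refines⇒coarsening : ∀ a {ν μ} → All (1 ≤_) ν → All (1 ≤_) μ → sum ν ≡ sum μ →
                     (∀ {s} → s ∈ psums a μ → s ∈ psums a ν) → Coarsening ν μ
refines⇒coarsening a {[]} {[]} pν pμ eq h = []
refines⇒coarsening a {suc _ ∷ ν} {[]} pν pμ () h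
refines⇒coarsening a {zero ∷ ν} {[]} (() ∷ _) pμ eq h
refines⇒coarsening a {ν} {m ∷ μ} pν (1≤m ∷ pμ) eq h with psums-split a ν (h (here refl))
... | ν₁ , ν₂ , refl , eq₁ = subst (λ k → Coarsening (ν₁ ++ ν₂) (k ∷ μ)) ν₁≡m
  (merge ν₁ (refines⇒coarsening (a + m) (All.++⁻ʳ ν₁ pν) pμ
    (+-cancelˡ-≡ m _ _ (trans (cong (_+ sum ν₂) (sym ν₁≡m)) (trans (sym (sum-++ ν₁ ν₂)) eq)))
    sub))
  where
  ν₁≡m : sum ν₁ ≡ m
  ν₁≡m = +-cancelˡ-≡ a _ _ eq₁
  sub : ∀ {s} → s ∈ psums (a + m) μ → s ∈ psums (a + m) ν₂
  sub {s} s∈ with ∈-++⁻ (psums a ν₁) (subst (s ∈_) (psums-++ a ν₁ ν₂) (h (there s∈)))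
  ... | inj₁ p = contradiction (subst (s ≤_) eq₁ (psums-≤ a ν₁ p)) (<⇒≱ (psums-> (a + m) pμ s∈))
  ... | inj₂ p = subst (λ b → s ∈ psums b ν₂) eq₁ p

take'-+ : ∀ m s (π : List ℕ) → take' (m + s) π ≡ take' m π ++ take' s (drop' m π)
take'-+ zero    s       π       = refl
take'-+ (suc m) zero    []      = refl
take'-+ (suc m) (suc s) []      = refl
take'-+ (suc m) s       (x ∷ π) = cong (x ∷_) (take'-+ m s π)

drop'-+ : ∀ m s (π : List ℕ) → drop' (m + s) π ≡ drop' s (drop' m π)
drop'-+ zero    s       π       = refl
drop'-+ (suc m) zero    []      = refl
drop'-+ (suc m) (suc s) []      = refl
drop'-+ (suc m) s       (x ∷ π) = drop'-+ m s π

≈ᴮ-split : ∀ ν₁ {ν a b} → blocks (ν₁ ++ ν) a ≈ᴮ blocks (ν₁ ++ ν) b →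
           take' (sum ν₁) a ↭ take' (sum ν₁) b × blocks ν (drop' (sum ν₁) a) ≈ᴮ blocks ν (drop' (sum ν₁) b)
≈ᴮ-split []       ps = ↭-refl , ps
≈ᴮ-split (m ∷ ν₁) {ν} {a} {b} (p ∷ ps) with ≈ᴮ-split ν₁ ps
... | r , rs rewrite take'-+ m (sum ν₁) a | take'-+ m (sum ν₁) b | drop'-+ m (sum ν₁) a | drop'-+ m (sum ν₁) b =
  ++⁺ p r , rs

coarsen-≈ᴮ : ∀ {ν μ a b} → Coarsening ν μ → blocks ν a ≈ᴮ blocks ν b → blocks μ a ≈ᴮ blocks μ b
coarsen-≈ᴮ []           ps = []
coarsen-≈ᴮ (merge ν₁ C) ps with ≈ᴮ-split ν₁ ps
... | r , rs = r ∷ coarsen-≈ᴮ C rs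

Both-split : ∀ {i} ν₁ {ν a} → Any (Both i) (blocks (ν₁ ++ ν) a) →
             Both i (take' (sum ν₁) a) ⊎ Any (Both i) (blocks ν (drop' (sum ν₁) a))
Both-split []       b = inj₂ b
Both-split (m ∷ ν₁) {ν} {a} b rewrite take'-+ m (sum ν₁) a | drop'-+ m (sum ν₁) a with b
... | here (i∈ , 1+i∈) = inj₁ (∈-++⁺ˡ i∈ , ∈-++⁺ˡ 1+i∈)
... | there b′ with Both-split ν₁ b′
...   | inj₁ (i∈ , 1+i∈) = inj₁ (∈-++⁺ʳ (take' m a) i∈ , ∈-++⁺ʳ (take' m a) 1+i∈)
...   | inj₂ r = inj₂ r

coarsen-Both : ∀ {i ν μ a} → Coarsening ν μ → Any (Both i) (blocks ν a) → Any (Both i) (blocks μ a)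
coarsen-Both []           b = b
coarsen-Both (merge ν₁ C) b with Both-split ν₁ b
... | inj₁ r = here r
... | inj₂ r = there (coarsen-Both C r)

anyBoth? : ∀ i bs → Dec (Any (Both i) bs)
anyBoth? i = Any.any? λ B → (i ∈? B) ×-dec (suc i ∈? B)

any-bothIn-true : ∀ {i bs} → Any (Both i) bs → any (bothIn i) bs ≡ true
any-bothIn-true {i} = T⇒≡true ∘ Any.any⁺ (bothIn i) ∘ Any.map (≡true⇒T ∘ bothIn-true)

any-bothIn-false : ∀ {i bs} → ¬ Any (Both i) bs → any (bothIn i) bs ≡ false
any-bothIn-false {i} {bs} nb = ¬T⇒≡false (nb ∘ Any.map from ∘ Any.any⁻ (bothIn i) bs)
  where
  from : ∀ {B} → T (bothIn i B) → Both i B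
  from {B} t with both? i B
  ... | inj₁ b = b
  ... | inj₂ n = contradiction t (subst (¬_ ∘ T) (sym (bothIn-false n)) λ ())

-- The identity cut into blocks

interval : ℕ → ℕ → List ℕ
interval a zero    = []
interval a (suc m) = suc a ∷ interval (suc a) m

map-suc-applyUpTo : ∀ a f m → (∀ x → f x ≡ a + x) → map suc (applyUpTo f m) ≡ interval a m
map-suc-applyUpTo a f zero    h = refl
map-suc-applyUpTo a f (suc m) h = cong₂ _∷_ (cong suc (trans (h 0) (+-identityʳ a)))
  (map-suc-applyUpTo (suc a) (f ∘ suc) m λ x → trans (h (suc x)) (+-suc a x))

oneToN≡interval : ∀ n → oneToN n ≡ interval 0 n
oneToN≡interval n = map-suc-applyUpTo 0 (λ x → x) n λ _ → refl

length-oneToN : ∀ n → length (oneToN n) ≡ n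
length-oneToN n = trans (length-map suc (upTo n)) (length-upTo n)

oneToN-unique : ∀ n → Unique (oneToN n)
oneToN-unique n = Unique.map⁺ suc-injective (Unique.upTo⁺ n)

nth-interval : ∀ a {m t} → t < m → nth (interval a m) t ≡ suc (a + t)
nth-interval a {suc m} {zero}  _       = cong suc (sym (+-identityʳ a))
nth-interval a {suc m} {suc t} (s≤s h) = trans (nth-interval (suc a) h) (cong suc (sym (+-suc a t)))

interval-≤ : ∀ a m {x} → x ∈ interval a m → x ≤ a + m
interval-≤ a (suc m) (here refl) = subst (suc a ≤_) (sym (+-suc a m)) (s≤s (m≤m+n a m))
interval-≤ a (suc m) {x} (there x∈) = subst (x ≤_) (sym (+-suc a m)) (interval-≤ (suc a) m x∈)

rank-interval-low : ∀ a m {x} → x ≤ suc a → rank (interval a m) x ≡ 0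
rank-interval-low a zero    h = refl
rank-interval-low a (suc m) {x} h = trans (count-false (_<ᵇ x) (interval (suc a) m) (<ᵇ-false (≤⇒≯ h)))
  (rank-interval-low (suc a) m (m≤n⇒m≤1+n h))

rank-interval : ∀ a m {t} → t ≤ m → rank (interval a m) (suc (a + t)) ≡ t
rank-interval a m       {zero}  _       = rank-interval-low a m (≤-reflexive (cong suc (+-identityʳ a)))
rank-interval a (suc m) {suc t} (s≤s h) = trans
  (count-true (_<ᵇ suc (a + suc t)) {suc a} (interval (suc a) m) (<ᵇ-true (s≤s (m<m+n a (s≤s z≤n)))))
  (cong suc (trans (cong (rank (interval (suc a) m) ∘ suc) (+-suc a t)) (rank-interval (suc a) m h)))

take'-interval : ∀ a m k → take' m (interval a (m + k)) ≡ interval a m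
take'-interval a zero    k = refl
take'-interval a (suc m) k = cong (suc a ∷_) (take'-interval (suc a) m k)

drop'-interval : ∀ a m k → drop' m (interval a (m + k)) ≡ interval (a + m) k
drop'-interval a zero    k = cong (λ b → interval b k) (sym (+-identityʳ a))
drop'-interval a (suc m) k = trans (drop'-interval (suc a) m k) (cong (λ b → interval b k) (sym (+-suc a m)))

length-interval : ∀ a m → length (interval a m) ≡ m
length-interval a zero    = refl
length-interval a (suc m) = cong suc (length-interval (suc a) m)

blocks-interval : ∀ a m μ → blocks (m ∷ μ) (interval a (m + sum μ)) ≡ interval a m ∷ blocks μ (interval (a + m) (sum μ))
blocks-interval a m μ = cong₂ _∷_ (take'-interval a m (sum μ)) (cong (blocks μ) (drop'-interval a m (sum μ)))

-- The blocks of the identity are already sorted. As this holds for every composition, the μ-places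
-- and ν-places agree at the start and the merging element begins as the identity.
slot-interval : ∀ a μ {t} → t < sum μ → slot (blocks μ (interval a (sum μ))) (suc (a + t)) ≡ t
slot-interval a (m ∷ μ) {t} t< =
  trans (cong (λ bs → slot bs (suc (a + t))) (blocks-interval a m μ)) (by-block (t <? m))
  where
  rest : List (List ℕ)
  rest = blocks μ (interval (a + m) (sum μ))
  by-block : Dec (t < m) → slot (interval a m ∷ rest) (suc (a + t)) ≡ t
  by-block (yes t<m) = trans (slot-here rest (nth⇒∈ (interval a m) t (nth-interval a t<m))) (rank-interval a m (<⇒≤ t<m))
  by-block (no t≮m) = trans (slot-there rest (λ p → t≮m (+-cancelˡ-< a _ _ (interval-≤ a m p))))
    (trans (cong₂ _+_ (length-interval a m)
      (trans (cong (slot rest ∘ suc) a+t)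
             (slot-interval (a + m) μ (+-cancelˡ-< m _ _ (subst (_< m + sum μ) (sym m+t′) t<)))))
      m+t′)
    where
    m+t′ : m + (t ∸ m) ≡ t
    m+t′ = m+[n∸m]≡n (≮⇒≥ t≮m)
    a+t : a + t ≡ a + m + (t ∸ m)
    a+t = trans (cong (a +_) (sym m+t′)) (sym (+-assoc a m _))

map-interval : ∀ g b c k → (∀ {t} → t < k → g (suc (b + t)) ≡ suc (c + t)) → map g (interval b k) ≡ interval c k
map-interval g b c zero    h = refl
map-interval g b c (suc k) h = cong₂ _∷_
  (trans (cong (g ∘ suc) (sym (+-identityʳ b))) (trans (h (s≤s z≤n)) (cong suc (+-identityʳ c))))
  (map-interval g (suc b) (suc c) k λ {t} t<k →
    trans (cong (g ∘ suc) (sym (+-suc b t))) (trans (h (s≤s t<k)) (cong suc (+-suc c t))))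

std-interval : ∀ a m → std (interval a m) ≡ interval 0 m
std-interval a m = map-interval (suc ∘ rank (interval a m)) a 0 m λ t<m → cong suc (rank-interval a m (<⇒≤ t<m))

isInvolution-interval : ∀ m → T (isInvolution (interval 0 m))
isInvolution-interval m = All.all⁻ (λ j → at (interval 0 m) (at (interval 0 m) j) ≡ᵇ j)
  (All.tabulate λ j∈ → ≡⇒≡ᵇ _ _ (fixed² (∈-oneToN⁻ j∈)))
  where
  fixed : ∀ {j} → InRange (length (interval 0 m)) j → at (interval 0 m) j ≡ j
  fixed {suc t} (_ , h) = nth-interval 0 (subst (t <_) (length-interval 0 m) h)
  fixed² : ∀ {j} → InRange (length (interval 0 m)) j → at (interval 0 m) (at (interval 0 m) j) ≡ j
  fixed² r rewrite fixed r = fixed r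

involutive-interval : ∀ a μ → InvolutiveBlocks (blocks μ (interval a (sum μ)))
involutive-interval a []      = []
involutive-interval a (m ∷ μ) = subst InvolutiveBlocks (sym (blocks-interval a m μ))
  (subst (T ∘ isInvolution) (sym (std-interval a m)) (isInvolution-interval m) ∷ involutive-interval (a + m) μ)

-- Right multiplication by 0-Hecke elements

Rs : List ℕ → List ℕ → List ℕ
Rs c w = foldr R w c

Rs-↭ : ∀ c w → Rs c w ↭ w
Rs-↭ []      w = ↭-refl
Rs-↭ (k ∷ c) w = ↭-trans (R-↭ k (Rs c w)) (Rs-↭ c w)

Rs-unique : ∀ c {w} → Unique w → Unique (Rs c w)
Rs-unique c {w} = Unique-resp-↭ (↭-sym (Rs-↭ c w))

L-Rs : ∀ i c {w} → Unique w → L i (Rs c w) ≡ Rs c (L i w)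
L-Rs i []      u = refl
L-Rs i (k ∷ c) {w} u = trans (L-R i k (Rs c w) (Rs-unique c u)) (cong (R k) (L-Rs i c u))

R≡swap0 : ∀ k w → nth w k < nth w (suc k) → R k w ≡ swap0 k w
R≡swap0 k w h = trans (R-nth k w) (if-true (<ᵇ-true h))

R≡id : ∀ k w → ¬ (nth w k < nth w (suc k)) → R k w ≡ w
R≡id k w h = trans (R-nth k w) (if-false (<ᵇ-false h))

swap0≡map-tr : ∀ {i} k w → Unique w → nth w k ≡ suc i → nth w (suc k) ≡ suc (suc i) →
               swap0 k w ≡ map (tr (suc i)) w
swap0≡map-tr {i} zero (x ∷ y ∷ w) u refl refl = sym (cong₂ _∷_ (tr-lo (suc i)) (cong₂ _∷_ (tr-hi (suc i))
  (map-tr-free (Unique⇒∉ u ∘ there) (Unique⇒∉ (Unique-tail u)))))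
swap0≡map-tr {i} (suc k) (x ∷ w) u p r = cong₂ _∷_
  (sym (tr-other (λ { refl → Unique⇒∉ u (nth⇒∈ w k p) }) (λ { refl → Unique⇒∉ u (nth⇒∈ w (suc k) r) })))
  (swap0≡map-tr k w (Unique-tail u) p r)

-- When consecutive places hold consecutive ascending values, exchanging the places and exchanging
-- the values are the same operation.
R≡L : ∀ {i} k w → Unique w → nth w k ≡ suc i → nth w (suc k) ≡ suc (suc i) → R k w ≡ L (suc i) w
R≡L {i} k w u p r = trans (R≡swap0 k w (subst₂ _<_ (sym p) (sym r) (n<1+n (suc i))))
  (trans (swap0≡map-tr k w u p r) (sym (trans (L-nth w k (suc k) u p r) (if-true (<ᵇ-true (n<1+n k))))))

nth-oneToN : ∀ {n t} → t < n → nth (oneToN n) t ≡ suc t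
nth-oneToN {n} {t} t<n = trans (cong (λ w → nth w t) (oneToN≡interval n)) (nth-interval 0 t<n)

R≡L-oneToN : ∀ {n k} → suc k < n → R k (oneToN n) ≡ L (suc k) (oneToN n)
R≡L-oneToN {n} {k} h = R≡L k (oneToN n) (oneToN-unique n) (nth-oneToN (<⇒≤ h)) (nth-oneToN h)

-- An induction principle whose every step is a left multiplication, and so commutes with each
-- `Rs c`.
data Reachable (n : ℕ) : List ℕ → Set where
  base : Reachable n (oneToN n)
  step : ∀ i {w} → Reachable n w → Reachable n (L i w)

reachable-unique : ∀ {n w} → Reachable n w → Unique w
reachable-unique {n} base = oneToN-unique n
reachable-unique (step i r) = L-unique i (reachable-unique r)

-- On the identity a right multiplication equals a left one, and commutation moves it there past all
-- earlier left multiplications.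
reachable-R : ∀ {n k w} → suc k < n → Reachable n w → Reachable n (R k w)
reachable-R {n} h base = subst (Reachable n) (sym (R≡L-oneToN h)) (step _ base)
reachable-R {n} {k} h (step i {w} r) = subst (Reachable n) (L-R i k w (reachable-unique r)) (step i (reachable-R h r))

-- A product of R's is right multiplication by a 0-Hecke element, which is read off at the identity.
Rs-determined : ∀ {n} c d → Rs c (oneToN n) ≡ Rs d (oneToN n) → ∀ {w} → Reachable n w → Rs c w ≡ Rs d w
Rs-determined c d eq base = eq
Rs-determined c d eq (step i r) = trans (sym (L-Rs i c (reachable-unique r)))
  (trans (cong (L i) (Rs-determined c d eq r)) (L-Rs i d (reachable-unique r)))

record Letter (n i : ℕ) : Set where
  constructor letter
  field
    positive : 1 ≤ i
    bounded  : suc i ≤ n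


-- One step of the action on a permutation

module Action {n : ℕ} {μ π : List ℕ} (|μ| : sum μ ≡ n) (π↭ : π ↭ oneToN n) where
  bs : List (List ℕ)
  bs = blocks μ π

  unique : Unique π
  unique = Unique-resp-↭ (↭-sym π↭) (oneToN-unique n)

  |π| : length π ≡ n
  |π| = trans (↭-length π↭) (length-oneToN n)

  |μ|≡|π| : sum μ ≡ length π
  |μ|≡|π| = trans |μ| (sym |π|)

  concat≡ : concat bs ≡ π
  concat≡ = concat-blocks {μ} π |μ|≡|π|

  unique-bs : Unique (concat bs)
  unique-bs = subst Unique (sym concat≡) unique

  ∈-π : ∀ {v} → v ∈ oneToN n → v ∈ π
  ∈-π = ∈-resp-↭ (↭-sym π↭)

  ∈-bs : ∀ {v} → v ∈ oneToN n → v ∈ concat bs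
  ∈-bs {v} = subst (v ∈_) (sym concat≡) ∘ ∈-π

  slot<n : ∀ {v} → v ∈ oneToN n → slot bs v < n
  slot<n {v} v∈ = subst (slot bs v <_) (trans (cong length concat≡) |π|) (slot-bound {bs} (∈-bs v∈))

  slot-inj : ∀ {v w} → v ∈ oneToN n → w ∈ oneToN n → slot bs v ≡ slot bs w → v ≡ w
  slot-inj v∈ w∈ = slot-injective {bs} (∈-bs v∈) (∈-bs w∈)

  module Step {i : ℕ} (ok : Letter n i) where
    open Letter ok

    i∈ : i ∈ oneToN n
    i∈ = ∈-oneToN⁺ (positive , <⇒≤ bounded)

    1+i∈ : suc i ∈ oneToN n
    1+i∈ = ∈-oneToN⁺ (s≤s z≤n , bounded)

    L-perm : L i π ↭ oneToN n
    L-perm = ↭-trans (L-↭ unique (∈-π i∈) (∈-π 1+i∈)) π↭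

    module Same (b : Any (Both i) bs) where
      open SameBlock (sameBlock unique-bs b) public

      muAct≡blocks : muAct μ π i ≡ concat (map (blockStepIf i) bs)
      muAct≡blocks = if-true (any-bothIn-true b)

      muAct≡ : muAct μ π i ≡ R (slot bs i) (L i π)
      muAct≡ = trans muAct≡blocks (trans act (cong (R (slot bs i) ∘ L i) concat≡))

      blocks-muAct : blocks μ (R (slot bs i) (L i π)) ≈ᴮ bs
      blocks-muAct = subst (_≈ᴮ bs)
        (sym (trans (cong (blocks μ) (trans (sym muAct≡) muAct≡blocks)) (blocks-concat {μ} π |μ|≡|π| act-≈))) act-≈

      blocks-L : blocks μ (L i π) ≈ᴮ bs
      blocks-L = subst (_≈ᴮ bs)
        (sym (trans (cong (blocks μ) (sym (trans Lbs-≡ (cong (L i) concat≡)))) (blocks-concat {μ} π |μ|≡|π| Lbs-≈))) Lbs-≈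

      involutive : InvolutiveBlocks bs → InvolutiveBlocks (blocks μ (muAct μ π i))
      involutive I = subst InvolutiveBlocks
        (sym (trans (cong (blocks μ) muAct≡blocks) (blocks-concat {μ} π |μ|≡|π| act-≈))) (involutive-step unique-bs I)

    module Diff (nb : ¬ Any (Both i) bs) where
      muAct≡ : muAct μ π i ≡ L i π
      muAct≡ = trans (if-false (any-bothIn-false {i} {bs} nb)) (hl≡L unique (∈-π i∈) (∈-π 1+i∈))

      order : (slot bs i < slot bs (suc i) × L i π ≡ map (tr i) π) ⊎ (slot bs (suc i) < slot bs i × L i π ≡ π)
      order = subst (λ w → (slot bs i < slot bs (suc i) × L i w ≡ map (tr i) w) ⊎ (slot bs (suc i) < slot bs i × L i w ≡ w))
        concat≡ (diffBlocks {i} {bs} (∈-bs i∈) (∈-bs 1+i∈) nb)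

      slot-tr : ∀ v → slot (blocks μ (map (tr i) π)) v ≡ slot bs (tr i v)
      slot-tr v = trans (cong (λ cs → slot cs v) (blocks-map (tr i) μ π)) (slot-map-tr {i} {bs} nb v)

      involutive : InvolutiveBlocks bs → InvolutiveBlocks (blocks μ (muAct μ π i))
      involutive I with order
      ... | inj₁ (_ , eq) = subst InvolutiveBlocks
            (sym (trans (cong (blocks μ) (trans muAct≡ eq)) (blocks-map (tr i) μ π))) (involutive-map-tr nb I)
      ... | inj₂ (_ , eq) = subst (InvolutiveBlocks ∘ blocks μ) (sym (trans muAct≡ eq)) I

    muAct-perm : muAct μ π i ↭ oneToN n
    muAct-perm with anyBoth? i bs
    ... | yes b = ↭-trans (↭-reflexive (Same.muAct≡ b)) (↭-trans (R-↭ (slot bs i) (L i π)) L-perm)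
    ... | no nb = ↭-trans (↭-reflexive (Diff.muAct≡ nb)) L-perm

    muAct-involutive : InvolutiveBlocks bs → InvolutiveBlocks (blocks μ (muAct μ π i))
    muAct-involutive with anyBoth? i bs
    ... | yes b = Same.involutive b
    ... | no nb = Diff.involutive nb

-- Running one word for a composition and for its refinement

tr-∈ : ∀ {n i v} → Letter n i → v ∈ oneToN n → tr i v ∈ oneToN n
tr-∈ (letter 1≤i i<n) = ∈-oneToN⁺ ∘ tr-range 1≤i i<n ∘ ∈-oneToN⁻

-- `τ` and `π` stand for the images of the identity under one word, for ν and for μ. The list `c`
-- spells the merging element; `reach` makes `Rs-determined` applicable to `τ`, and `same` lets
-- every case distinction about `π` be made on `τ`.
record Coupled (n : ℕ) (ν μ τ π : List ℕ) : Set where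
  field
    τ↭    : τ ↭ oneToN n
    reach : Reachable n τ
    c     : List ℕ
    c-π   : Rs c τ ≡ π
    same  : blocks μ π ≈ᴮ blocks μ τ
    -- Rs c e turns places after sorting the μ-blocks into places after sorting the ν-blocks, so it is a
    -- function of τ.
    rel   : ∀ {v} → v ∈ oneToN n →
            nth (Rs c (oneToN n)) (slot (blocks μ τ) v) ≡ suc (slot (blocks ν τ) v)

coupled-base : ∀ {n ν μ} → sum ν ≡ n → sum μ ≡ n → Coupled n ν μ (oneToN n) (oneToN n)
coupled-base {n} {ν} {μ} |ν| |μ| = record
  { τ↭ = ↭-refl ; reach = base ; c = [] ; c-π = refl ; same = ≈ᴮ-refl ; rel = rel ∘ ∈-oneToN⁻ }
  where
  slot-oneToN : ∀ {λs t} → sum λs ≡ n → t < n → slot (blocks λs (oneToN n)) (suc t) ≡ t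
  slot-oneToN {λs} {t} refl t<n = trans (cong (λ w → slot (blocks λs w) (suc t)) (oneToN≡interval n)) (slot-interval 0 λs t<n)
  rel : ∀ {v} → InRange n v → nth (oneToN n) (slot (blocks μ (oneToN n)) v) ≡ suc (slot (blocks ν (oneToN n)) v)
  rel {suc t} (_ , t<n) rewrite slot-oneToN {ν} |ν| t<n | slot-oneToN {μ} |μ| t<n = nth-oneToN t<n

coupled-step : ∀ {n ν μ τ π i} → sum ν ≡ n → sum μ ≡ n → Coarsening ν μ → Letter n i →
               Coupled n ν μ τ π → Coupled n ν μ (muAct ν τ i) (muAct μ π i)
coupled-step {n} {ν} {μ} {τ} {π} {i} |ν| |μ| C ok K = go (anyBoth? i (blocks ν τ)) (anyBoth? i (blocks μ τ))
  where
  open Coupled K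
  π↭ : π ↭ oneToN n
  π↭ = ↭-trans (↭-reflexive (sym c-π)) (↭-trans (Rs-↭ c τ) τ↭)
  module ντ = Action {μ = ν} |ν| τ↭
  module μτ = Action {μ = μ} |μ| τ↭
  module μπ = Action {μ = μ} |μ| π↭
  module ντᵢ = ντ.Step ok
  module μτᵢ = μτ.Step ok
  module μπᵢ = μπ.Step ok
  open ντᵢ using (i∈; 1+i∈)

  e u : List ℕ
  e = oneToN n
  u = Rs c e

  j k : ℕ
  j = slot (blocks ν τ) i
  k = slot (blocks μ τ) i

  k≡ : slot (blocks μ π) i ≡ k
  k≡ = slot-cong same i

  u-unique : Unique u
  u-unique = Rs-unique c (oneToN-unique n)

  Lτ-reach : Reachable n (L i τ)
  Lτ-reach = step i reach

  Lπ : L i π ≡ Rs c (L i τ)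
  Lπ = trans (cong (L i) (sym c-π)) (L-Rs i c ντ.unique)

  within-ν : Any (Both i) (blocks ν τ) → Coupled n ν μ (muAct ν τ i) (muAct μ π i)
  within-ν b = subst₂ (Coupled n ν μ) (sym N.muAct≡) (sym (trans P.muAct≡ (cong (λ t → R t (L i π)) k≡))) record
    { τ↭    = ↭-trans (R-↭ j (L i τ)) ντᵢ.L-perm
    ; reach = reachable-R 1+j<n Lτ-reach
    ; c     = c
    ; c-π   = begin
        Rs c (R j (L i τ))        ≡⟨ sym (foldr-++ R (L i τ) c [ j ]) ⟩
        Rs (c ++ [ j ]) (L i τ)   ≡⟨ Rs-determined (c ++ [ j ]) (k ∷ c) cj≡kc Lτ-reach ⟩
        R k (Rs c (L i τ))        ≡⟨ cong (R k) (sym Lπ) ⟩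
        R k (L i π)               ∎
    ; same  = ≈ᴮ-trans (subst (λ t → blocks μ (R t (L i π)) ≈ᴮ blocks μ π) k≡ P.blocks-muAct)
                (≈ᴮ-trans same (≈ᴮ-sym blocks-μ))
    ; rel   = λ {v} v∈ → trans (cong (nth u) (slot-cong blocks-μ v))
                (trans (rel v∈) (cong suc (sym (slot-cong N.blocks-muAct v))))
    }
    where
    open ≡-Reasoning
    bμ : Any (Both i) (blocks μ τ)
    bμ = coarsen-Both C b
    module N = ντᵢ.Same b
    module M = μτᵢ.Same bμ
    module P = μπᵢ.Same (≈ᴮ-Both (≈ᴮ-sym same) bμ)
    blocks-μ : blocks μ (R j (L i τ)) ≈ᴮ blocks μ τ
    blocks-μ = coarsen-≈ᴮ C N.blocks-muAct
    1+j<n : suc j < n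
    1+j<n = subst (_< n) N.slot-suc (ντ.slot<n 1+i∈)
    -- On the identity, `R j` is a left multiplication and so passes through `c`. In `u` the values
    -- `suc j`, `suc (suc j)` stand at the places `k`, `suc k`, where it becomes `R k`.
    cj≡kc : Rs (c ++ [ j ]) e ≡ Rs (k ∷ c) e
    cj≡kc = begin
      Rs (c ++ [ j ]) e   ≡⟨ foldr-++ R e c [ j ] ⟩
      Rs c (R j e)        ≡⟨ cong (Rs c) (R≡L-oneToN 1+j<n) ⟩
      Rs c (L (suc j) e)  ≡⟨ sym (L-Rs (suc j) c (oneToN-unique n)) ⟩
      L (suc j) u         ≡⟨ sym (R≡L k u u-unique (rel i∈)
                               (trans (cong (nth u) (sym M.slot-suc)) (trans (rel 1+i∈) (cong suc N.slot-suc)))) ⟩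
      R k u               ∎

  within-μ : ¬ Any (Both i) (blocks ν τ) → Any (Both i) (blocks μ τ) → Coupled n ν μ (muAct ν τ i) (muAct μ π i)
  within-μ nb b = subst₂ (Coupled n ν μ) (sym N.muAct≡) (sym (trans P.muAct≡ (cong (λ t → R t (L i π)) k≡))) (by-order N.order)
    where
    open ≡-Reasoning
    module N = ντᵢ.Diff nb
    module M = μτᵢ.Same b
    module P = μπᵢ.Same (≈ᴮ-Both (≈ᴮ-sym same) b)
    nth-k : nth u k ≡ suc (slot (blocks ν τ) i)
    nth-k = rel i∈
    nth-1+k : nth u (suc k) ≡ suc (slot (blocks ν τ) (suc i))
    nth-1+k = trans (cong (nth u) (sym M.slot-suc)) (rel 1+i∈)

    tr-slot : ∀ {v} → v ∈ e → tr k (slot (blocks μ τ) v) ≡ slot (blocks μ τ) (tr i v)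
    tr-slot {v} v∈ with view i v
    ... | lo = trans (tr-lo k) (trans (sym M.slot-suc) (cong (slot (blocks μ τ)) (sym (tr-lo i))))
    ... | hi = trans (cong (tr k) M.slot-suc) (trans (tr-hi k) (cong (slot (blocks μ τ)) (sym (tr-hi i))))
    ... | other a a′ = trans
          (tr-other (a ∘ μτ.slot-inj v∈ i∈) (λ eq → a′ (μτ.slot-inj v∈ 1+i∈ (trans eq (sym M.slot-suc)))))
          (cong (slot (blocks μ τ)) (sym (tr-other a a′)))

    by-order : (slot (blocks ν τ) i < slot (blocks ν τ) (suc i) × L i τ ≡ map (tr i) τ) ⊎
               (slot (blocks ν τ) (suc i) < slot (blocks ν τ) i × L i τ ≡ τ) →
               Coupled n ν μ (L i τ) (R k (L i π))
    by-order (inj₁ (lt , eq)) = record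
      { τ↭    = ντᵢ.L-perm
      ; reach = Lτ-reach
      -- The ν-action has no right factor here, so the factor at `k` joins the merging element.
      ; c     = k ∷ c
      ; c-π   = cong (R k) (sym Lπ)
      ; same  = ≈ᴮ-trans (subst (λ t → blocks μ (R t (L i π)) ≈ᴮ blocks μ π) k≡ P.blocks-muAct)
                  (≈ᴮ-trans same (≈ᴮ-sym M.blocks-L))
      ; rel   = λ {v} v∈ → begin
          nth (R k u) (slot (blocks μ (L i τ)) v)
            ≡⟨ cong₂ nth (R≡swap0 k u (subst₂ _<_ (sym nth-k) (sym nth-1+k) (s≤s lt))) (slot-cong M.blocks-L v) ⟩
          nth (swap0 k u) (slot (blocks μ τ) v)
            ≡⟨ nth-swap0 k u (nth-bound u (suc k) nth-1+k) _ ⟩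
          nth u (tr k (slot (blocks μ τ) v))
            ≡⟨ cong (nth u) (tr-slot v∈) ⟩
          nth u (slot (blocks μ τ) (tr i v))
            ≡⟨ rel (tr-∈ ok v∈) ⟩
          suc (slot (blocks ν τ) (tr i v))
            ≡⟨ cong suc (sym (N.slot-tr v)) ⟩
          suc (slot (blocks ν (map (tr i) τ)) v)
            ≡⟨ cong (λ w → suc (slot (blocks ν w) v)) (sym eq) ⟩
          suc (slot (blocks ν (L i τ)) v) ∎
      }
    -- The ν-block of `suc i` comes first, so `u` already descends at `k`: `R k` fixes `u`, hence
    -- also `π`.
    by-order (inj₂ (gt , eq)) = subst₂ (Coupled n ν μ) (sym eq) (sym Rk≡π) K
      where
      Lπ≡π : L i π ≡ π
      Lπ≡π = trans Lπ (trans (cong (Rs c) eq) c-π)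
      Rk≡π : R k (L i π) ≡ π
      Rk≡π = begin
        R k (L i π)   ≡⟨ cong (R k) (trans Lπ≡π (sym c-π)) ⟩
        Rs (k ∷ c) τ  ≡⟨ Rs-determined (k ∷ c) c
                           (R≡id k u (subst₂ (λ a b → ¬ (a < b)) (sym nth-k) (sym nth-1+k) (<⇒≯ (s≤s gt)))) reach ⟩
        Rs c τ        ≡⟨ c-π ⟩
        π             ∎

  across-μ : ¬ Any (Both i) (blocks μ τ) → Coupled n ν μ (muAct ν τ i) (muAct μ π i)
  across-μ nbμ = subst₂ (Coupled n ν μ) (sym N.muAct≡) (sym P.muAct≡) (by-order M.order P.order)
    where
    open ≡-Reasoning
    nbν : ¬ Any (Both i) (blocks ν τ)
    nbν = nbμ ∘ coarsen-Both C
    nbπ : ¬ Any (Both i) (blocks μ π)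
    nbπ = nbμ ∘ ≈ᴮ-Both same
    module N = ντᵢ.Diff nbν
    module M = μτᵢ.Diff nbμ
    module P = μπᵢ.Diff nbπ
    by-order : (slot (blocks μ τ) i < slot (blocks μ τ) (suc i) × L i τ ≡ map (tr i) τ) ⊎
               (slot (blocks μ τ) (suc i) < slot (blocks μ τ) i × L i τ ≡ τ) →
               (slot (blocks μ π) i < slot (blocks μ π) (suc i) × L i π ≡ map (tr i) π) ⊎
               (slot (blocks μ π) (suc i) < slot (blocks μ π) i × L i π ≡ π) →
               Coupled n ν μ (L i τ) (L i π)
    by-order (inj₂ (_ , eq)) (inj₂ (_ , eq′)) = subst₂ (Coupled n ν μ) (sym eq) (sym eq′) K
    -- The μ-slots of `τ` and `π` coincide, which excludes the mixed alternatives.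
    by-order (inj₁ (lt , _)) (inj₂ (gt , _)) =
      contradiction gt (<⇒≯ (subst₂ _<_ (sym k≡) (sym (slot-cong same (suc i))) lt))
    by-order (inj₂ (gt , _)) (inj₁ (lt , _)) =
      contradiction lt (<⇒≯ (subst₂ _<_ (sym (slot-cong same (suc i))) (sym k≡) gt))
    by-order (inj₁ (_ , eq)) (inj₁ (_ , eq′)) = record
      { τ↭    = ντᵢ.L-perm
      ; reach = Lτ-reach
      ; c     = c
      ; c-π   = sym Lπ
      ; same  = subst₂ _≈ᴮ_ (blocks-tr π eq′) (blocks-tr τ eq)
                  (Pointwise.map⁺ (map (tr i)) (map (tr i)) (Pointwise.map (↭-map⁺ (tr i)) same))
      ; rel   = λ {v} v∈ → begin
          nth u (slot (blocks μ (L i τ)) v)       ≡⟨ cong (λ w → nth u (slot (blocks μ w) v)) eq ⟩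
          nth u (slot (blocks μ (map (tr i) τ)) v) ≡⟨ cong (nth u) (M.slot-tr v) ⟩
          nth u (slot (blocks μ τ) (tr i v))      ≡⟨ rel (tr-∈ ok v∈) ⟩
          suc (slot (blocks ν τ) (tr i v))        ≡⟨ cong suc (sym (N.slot-tr v)) ⟩
          suc (slot (blocks ν (map (tr i) τ)) v)  ≡⟨ cong (λ w → suc (slot (blocks ν w) v)) (sym eq) ⟩
          suc (slot (blocks ν (L i τ)) v)         ∎
      }
      where
      blocks-tr : ∀ w → L i w ≡ map (tr i) w → map (map (tr i)) (blocks μ w) ≡ blocks μ (L i w)
      blocks-tr w eq = trans (sym (blocks-map (tr i) μ w)) (cong (blocks μ) (sym eq))

  go : Dec (Any (Both i) (blocks ν τ)) → Dec (Any (Both i) (blocks μ τ)) → Coupled n ν μ (muAct ν τ i) (muAct μ π i)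
  go (yes bν) _        = within-ν bν
  go (no nbν) (yes bμ) = within-μ nbν bμ
  go (no _)   (no nbμ) = across-μ nbμ

-- If some `j` were missed, punching it out would leave an injection into a set with one element
-- fewer.
injective⇒surjective : ∀ {n} (f : Fin n → Fin n) → Injective _≡_ _≡_ f → ∀ j → ∃ λ i → f i ≡ j
injective⇒surjective {suc m} f inj j with Fin.any? (λ i → f i Fin.≟ j)
... | yes hit = hit
... | no miss = contradiction (Fin.injective⇒≤ {f = λ i → punchOut (j≢f i)}
                  (λ {i} {i′} → inj ∘ Fin.punchOut-injective (j≢f i) (j≢f i′))) (<⇒≱ (n<1+n m))
  where
  j≢f : ∀ i → j ≢ f i
  j≢f i eq = miss (i , sym eq)

module _ {n : ℕ} {μ π : List ℕ} (|μ| : sum μ ≡ n) (π↭ : π ↭ oneToN n) where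
  open Action {μ = μ} |μ| π↭

  slot-surjective : ∀ {t} → t < n → ∃ λ v → v ∈ oneToN n × slot bs v ≡ t
  slot-surjective {t} t<n with injective⇒surjective f f-injective (fromℕ< t<n)
    where
    value∈ : ∀ (i : Fin n) → suc (toℕ i) ∈ oneToN n
    value∈ i = ∈-oneToN⁺ (s≤s z≤n , Fin.toℕ<n i)
    f : Fin n → Fin n
    f i = fromℕ< (slot<n (value∈ i))
    f-injective : Injective _≡_ _≡_ f
    f-injective {i} {i′} eq = Fin.toℕ-injective (suc-injective (slot-inj (value∈ i) (value∈ i′)
      (Fin.fromℕ<-injective _ _ _ _ eq)))
  ... | i , eq = suc (toℕ i) , ∈-oneToN⁺ (s≤s z≤n , Fin.toℕ<n i) , Fin.fromℕ<-injective _ _ _ _ eq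

nth-ext : ∀ u v → length u ≡ length v → (∀ {t} → t < length u → nth u t ≡ nth v t) → u ≡ v
nth-ext []      []      _  _ = refl
nth-ext (x ∷ u) (y ∷ v) eq h = cong₂ _∷_ (h (s≤s z≤n)) (nth-ext u v (suc-injective eq) (h ∘ s≤s))

-- `rel` prescribes the entry of the merging element at each μ-slot of `τ`, and the slots exhaust
-- all places. Both lists therefore spell the same element, and it acts in the same way on `τ`.
coupled-functional : ∀ {n ν μ τ π π′} → sum μ ≡ n → Coupled n ν μ τ π → Coupled n ν μ τ π′ → π ≡ π′
coupled-functional {n} {ν} {μ} {τ} |μ| K K′ =
  trans (sym K.c-π) (trans (Rs-determined K.c K′.c u≡u′ K.reach) K′.c-π)
  where
  module K  = Coupled K
  module K′ = Coupled K′
  |u| : ∀ c → length (Rs c (oneToN n)) ≡ n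
  |u| c = trans (↭-length (Rs-↭ c (oneToN n))) (length-oneToN n)
  u≡u′ : Rs K.c (oneToN n) ≡ Rs K′.c (oneToN n)
  u≡u′ = nth-ext _ _ (trans (|u| K.c) (sym (|u| K′.c))) λ {t} t< →
    let v , v∈ , eq = slot-surjective {μ = μ} |μ| K.τ↭ (subst (t <_) (|u| K.c) t<)
    in subst (λ t → nth (Rs K.c (oneToN n)) t ≡ nth (Rs K′.c (oneToN n)) t) eq
         (trans (K.rel v∈) (sym (K′.rel v∈)))

coupled-word : ∀ {n ν μ τ π} → sum ν ≡ n → sum μ ≡ n → Coarsening ν μ → ∀ {a} → All (Letter n) a →
               Coupled n ν μ τ π → Coupled n ν μ (actWord ν τ a) (actWord μ π a)
coupled-word |ν| |μ| C []        K = K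
coupled-word |ν| |μ| C (ok ∷ as) K = coupled-word |ν| |μ| C as (coupled-step |ν| |μ| C ok K)

actWord-coarsen : ∀ {n ν μ a b} → sum ν ≡ n → sum μ ≡ n → Coarsening ν μ → All (Letter n) a → All (Letter n) b →
                  actWord ν (oneToN n) a ≡ actWord ν (oneToN n) b → actWord μ (oneToN n) a ≡ actWord μ (oneToN n) b
actWord-coarsen {n} {ν} {μ} {a} {b} |ν| |μ| C oka okb eq = coupled-functional |μ|
  (subst (λ τ → Coupled n ν μ τ (actWord μ (oneToN n) a)) eq (coupled-word |ν| |μ| C oka (coupled-base |ν| |μ|)))
  (coupled-word |ν| |μ| C okb (coupled-base |ν| |μ|))

actWord-valid : ∀ {n ν τ a} → sum ν ≡ n → All (Letter n) a → τ ↭ oneToN n → InvolutiveBlocks (blocks ν τ) →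
                actWord ν τ a ↭ oneToN n × InvolutiveBlocks (blocks ν (actWord ν τ a))
actWord-valid |ν| []        τ↭ I = τ↭ , I
actWord-valid {ν = ν} |ν| (ok ∷ as) τ↭ I = actWord-valid |ν| as muAct-perm (muAct-involutive I)
  where open Action.Step {μ = ν} |ν| τ↭ ok

involutive-oneToN : ∀ {n ν} → sum ν ≡ n → InvolutiveBlocks (blocks ν (oneToN n))
involutive-oneToN {ν = ν} refl = subst (InvolutiveBlocks ∘ blocks ν) (sym (oneToN≡interval (sum ν))) (involutive-interval 0 ν)

-- Reduced words and the sets 𝒜_μ(π)

-- With the start value 1, the 1-based answer `j` is `suc k`, so `rmul w j` is `swap0 k w`.
descent-just : ∀ i w {j} → descent i w ≡ just j →
               ∃ λ k → j ≡ i + k × suc k < length w × len (swap0 k w) < len w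
descent-just i (x ∷ y ∷ w) {j} eq with y <ᵇ x in lt | descent-just (suc i) (y ∷ w) {j}
descent-just i (x ∷ y ∷ w) refl | true | _ =
  0 , sym (+-identityʳ i) , s≤s (s≤s z≤n) ,
  subst (len (y ∷ x ∷ w) <_) (cong (_+ (rank w y + len w)) (count-true (_<ᵇ x) {y} w lt))
    (len-swap-< {y} {x} w (<ᵇ-true⁻ {y} {x} lt))
... | false | rec with rec eq
...   | k , refl , k< , shorter = suc k , sym (+-suc i k) , s≤s k< ,
        +-mono-≤-< (≤-reflexive (trans (count-↭ (_<ᵇ x) (swap0-↭ k (y ∷ w))) (count-false (_<ᵇ x) {y} w lt))) shorter

-- Each letter removes an inversion, which bounds the length of the word. For members of an 𝒜-set
-- the opposite inequality will come from minimality.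
redWordF-spec : ∀ {n} f w → length w ≡ n → All (Letter n) (redWordF f w) × length (redWordF f w) ≤ len w
redWordF-spec zero    w |w| = [] , z≤n
redWordF-spec {n} (suc f) w |w| with firstDescent w in eq
... | nothing = [] , z≤n
... | just i with descent-just 1 w (trans (sym (firstDescent≡descent w)) eq)
...   | k , refl , k< , shorter
      with redWordF-spec {n} f (swap0 k w) (trans (↭-length (swap0-↭ k w)) |w|)
...     | letters , bound = All.++⁺ letters (letter (s≤s z≤n) (subst (suc k <_) |w| k<) ∷ []) ,
          subst (_≤ len w) (sym (trans (length-++ (redWordF f (swap0 k w))) (+-comm _ 1))) (≤-trans (s≤s bound) shorter)

Letter⇔∈ : ∀ {n i} → (Letter n i → i ∈ oneToN (n ∸ 1)) × (i ∈ oneToN (n ∸ 1) → Letter n i)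
Letter⇔∈ {n} {i} = (λ { (letter 1≤i (s≤s i≤)) → ∈-oneToN⁺ (1≤i , i≤) }) , from ∘ ∈-oneToN⁻
  where
  from : ∀ {n} → InRange (n ∸ 1) i → Letter n i
  from {zero}  (1≤i , i≤0) = contradiction (≤-trans 1≤i i≤0) λ ()
  from {suc n} (1≤i , i≤n) = letter 1≤i (s≤s i≤n)

∈-words⁺ : ∀ {n a} → All (Letter n) a → a ∈ words n (length a)
∈-words⁺ []        = here refl
∈-words⁺ {n} {i ∷ a} (ok ∷ oks) = ∈-concatMap⁺ (λ x → map (x ∷_) (words n (length a)))
  (Any.map (λ { refl → ∈-map⁺ (i ∷_) (∈-words⁺ oks) }) (proj₁ Letter⇔∈ ok))

∈-words⁻ : ∀ {n} p {a} → a ∈ words n p → All (Letter n) a × length a ≡ p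
∈-words⁻ zero    (here refl) = [] , refl
∈-words⁻ {n} (suc p) a∈ with find (∈-concatMap⁻ (λ x → map (x ∷_) (words n p)) {xs = oneToN (n ∸ 1)} a∈)
... | i , i∈ , a∈′ with ∈-map⁻ (i ∷_) a∈′
...   | b , b∈ , refl with ∈-words⁻ p b∈
...     | oks , eq = proj₂ Letter⇔∈ i∈ ∷ oks , cong suc eq

eqL⇒≡ : ∀ u v → T (eqL u v) → u ≡ v
eqL⇒≡ []      []      _ = refl
eqL⇒≡ (x ∷ u) (y ∷ v) t with Equivalence.to T-∧ t
... | p , r = cong₂ _∷_ (≡ᵇ⇒≡ x y p) (eqL⇒≡ u v r)

eqL-refl : ∀ u → T (eqL u u)
eqL-refl []      = _
eqL-refl (x ∷ u) = Equivalence.from T-∧ (≡⇒≡ᵇ x x refl , eqL-refl u)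

Reached : ℕ → List ℕ → List ℕ → ℕ → Set
Reached n μ π p = ∃ λ a → All (Letter n) a × length a ≡ p × actWord μ (oneToN n) a ≡ π

reachableIn⁻ : ∀ {n μ π p} → T (reachableIn n μ π p) → Reached n μ π p
reachableIn⁻ {n} {μ} {π} {p} t with find (Any.any⁻ _ (words n p) t)
... | a , a∈ , eq with ∈-words⁻ p a∈
...   | oks , |a| = a , oks , |a| , eqL⇒≡ _ _ eq

reachableIn⁺ : ∀ {n μ π p} → Reached n μ π p → T (reachableIn n μ π p)
reachableIn⁺ {n} {μ} {π} (a , oks , refl , refl) = Any.any⁺ (λ a → eqL (actWord μ (oneToN n) a) π)
  (Any.map (λ { refl → eqL-refl (actWord μ (oneToN n) a) }) (∈-words⁺ oks))

record InA (n : ℕ) (μ π w : List ℕ) : Set where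
  constructor mkInA
  field
    acts    : eAct n μ w ≡ π
    reached : Reached n μ π (len w)
    minimal : ∀ {p} → p < len w → ¬ Reached n μ π p

inA⁻ : ∀ {n μ π w} → T (inA n μ π w) → InA n μ π w
inA⁻ {n} {μ} {π} {w} t with Equivalence.to T-∧ t
... | eq , t′ with Equivalence.to T-∧ t′
...   | r , m = mkInA (eqL⇒≡ _ _ eq) (reachableIn⁻ r) λ p< reach →
        subst T (Equivalence.to T-not-≡ m)
          (Any.any⁺ (reachableIn n μ π) (Any.map (λ { refl → reachableIn⁺ reach }) (∈-upTo⁺ p<)))

inA⁺ : ∀ {n μ π w} → InA n μ π w → T (inA n μ π w)
inA⁺ {n} {μ} {π} {w} (mkInA refl r m) = Equivalence.from T-∧ (eqL-refl (eAct n μ w) ,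
  Equivalence.from T-∧ (reachableIn⁺ r , Equivalence.from T-not-≡ (¬T⇒≡false λ t →
    let p , p∈ , rp = find (Any.any⁻ (reachableIn n μ π) (upTo (len w)) t) in m (∈-upTo⁻ p∈) (reachableIn⁻ rp))))

module Refinement {n : ℕ} {ν μ : List ℕ} (|ν| : sum ν ≡ n) (|μ| : sum μ ≡ n) (C : Coarsening ν μ) where

  letters : ∀ {w} → length w ≡ n → All (Letter n) (redWord w)
  letters {w} |w| = proj₁ (redWordF-spec (suc (len w)) w |w|)

  reached-coarsen : ∀ {w p} → length w ≡ n → Reached n ν (eAct n ν w) p → Reached n μ (eAct n μ w) p
  reached-coarsen {w} |w| (a , oks , |a| , eq) = a , oks , |a| , actWord-coarsen |ν| |μ| C oks (letters {w} |w|) eq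

  inA-refine : ∀ {π w} → length w ≡ n → InA n μ π w → InA n ν (eAct n ν w) w
  inA-refine {π} {w} |w| (mkInA refl r m) = mkInA refl
    (redWord w , letters {w} |w| , redWord-length , refl)
    λ p< reach → m p< (reached-coarsen {w} |w| reach)
    where
    -- A shorter word would reach `π` too early, contradicting the minimality of `len w`.
    redWord-length : length (redWord w) ≡ len w
    redWord-length = ≤-antisym (proj₂ (redWordF-spec (suc (len w)) w |w|))
      (≮⇒≥ λ short → m short (redWord w , letters {w} |w| , refl , refl))

  inA-coarsen : ∀ {π w w′} → length w ≡ n → length w′ ≡ n →
                InA n μ π w → InA n ν (eAct n ν w) w′ → InA n μ π w′
  inA-coarsen {π} {w} {w′} |w| |w′| A@(mkInA acts r m) (mkInA acts′ r′ m′) = mkInA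
    (trans (actWord-coarsen |ν| |μ| C (letters {w′} |w′|) (letters {w} |w|) acts′) acts)
    (subst (Reached n μ π) same-len r)
    λ p< → m (subst (_ <_) (sym same-len) p<)
    where
    open InA (inA-refine {π} {w} |w| A) using () renaming (reached to rν; minimal to mν)
    -- Both lengths are minimal for the same element e ∘_ν w.
    same-len : len w ≡ len w′
    same-len with <-cmp (len w) (len w′)
    ... | tri< lt _ _ = contradiction rν (m′ lt)
    ... | tri≈ _ eq _ = eq
    ... | tri> _ _ gt = contradiction r′ (mν gt)

-- Sums of coefficients over permutations

∑ : ∀ {A : Set} → (A → ℤ) → List A → ℤ
∑ f = foldr (λ x s → f x +ℤ s) 0ℤ

when : Bool → ℤ → ℤ
when b z = if b then z else 0ℤ

∑-cong : ∀ {A : Set} {f g : A → ℤ} xs → (∀ {x} → x ∈ xs → f x ≡ g x) → ∑ f xs ≡ ∑ g xs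
∑-cong []       h = refl
∑-cong (x ∷ xs) h = cong₂ _+ℤ_ (h (here refl)) (∑-cong xs (h ∘ there))

∑-zero : ∀ {A : Set} (xs : List A) → ∑ (λ _ → 0ℤ) xs ≡ 0ℤ
∑-zero []       = refl
∑-zero (x ∷ xs) = trans (ℤ.+-identityˡ _) (∑-zero xs)

∑-++ : ∀ {A : Set} (f : A → ℤ) xs ys → ∑ f (xs ++ ys) ≡ ∑ f xs +ℤ ∑ f ys
∑-++ f []       ys = sym (ℤ.+-identityˡ _)
∑-++ f (x ∷ xs) ys = trans (cong (f x +ℤ_) (∑-++ f xs ys)) (sym (ℤ.+-assoc (f x) _ _))

∑-map : ∀ {A B : Set} (f : B → ℤ) (g : A → B) xs → ∑ f (map g xs) ≡ ∑ (f ∘ g) xs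
∑-map f g []       = refl
∑-map f g (x ∷ xs) = cong (f (g x) +ℤ_) (∑-map f g xs)

∑-concatMap : ∀ {A B : Set} (f : B → ℤ) (g : A → List B) xs → ∑ f (concatMap g xs) ≡ ∑ (λ x → ∑ f (g x)) xs
∑-concatMap f g []       = refl
∑-concatMap f g (x ∷ xs) = trans (∑-++ f (g x) (concatMap g xs)) (cong (∑ f (g x) +ℤ_) (∑-concatMap f g xs))

∑-filter : ∀ {A : Set} (b : A → Bool) (f : A → ℤ) xs → ∑ f (filterᵇ b xs) ≡ ∑ (λ x → when (b x) (f x)) xs
∑-filter b f []       = refl
∑-filter b f (x ∷ xs) with b x
... | true  = cong (f x +ℤ_) (∑-filter b f xs)
... | false = trans (∑-filter b f xs) (sym (ℤ.+-identityˡ _))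

∑-+ : ∀ {A : Set} (f g : A → ℤ) xs → ∑ (λ x → f x +ℤ g x) xs ≡ ∑ f xs +ℤ ∑ g xs
∑-+ f g []       = refl
∑-+ f g (x ∷ xs) = trans (cong (f x +ℤ g x +ℤ_) (∑-+ f g xs)) (interchange ℤ.+-commutativeSemigroup (f x) (g x) (∑ f xs) (∑ g xs))

∑-swap : ∀ {A B : Set} (f : A → B → ℤ) xs ys → ∑ (λ x → ∑ (f x) ys) xs ≡ ∑ (λ y → ∑ (λ x → f x y) xs) ys
∑-swap f []       ys = sym (∑-zero ys)
∑-swap f (x ∷ xs) ys = trans (cong (∑ (f x) ys +ℤ_) (∑-swap f xs ys)) (sym (∑-+ (f x) (λ y → ∑ (λ x → f x y) xs) ys))

when-∑ : ∀ {A : Set} b (f : A → ℤ) xs → when b (∑ f xs) ≡ ∑ (λ x → when b (f x)) xs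
when-∑ true  f xs = refl
when-∑ false f xs = sym (∑-zero xs)

when-∧ : ∀ a b z → when a (when b z) ≡ when (a ∧ b) z
when-∧ true  b z = refl
when-∧ false b z = refl

-- Polynomials are unreduced lists of terms, so equality is tested coefficient by coefficient, and
-- there concatenation is addition.
coeff-++ : ∀ {n} (p r : Poly n) c → coeff (p ++ r) c ≡ coeff p c +ℤ coeff r c
coeff-++ []            r c = sym (ℤ.+-identityˡ _)
coeff-++ ((z , e) ∷ p) r c with eqV e c
... | true  = trans (cong (z +ℤ_) (coeff-++ p r c)) (sym (ℤ.+-assoc z _ _))
... | false = coeff-++ p r c

coeff-sumP : ∀ {n} {A : Set} (S : A → Poly n) xs c → coeff (sumP (map S xs)) c ≡ ∑ (λ x → coeff (S x) c) xs
coeff-sumP S []       c = refl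
coeff-sumP S (x ∷ xs) c = trans (coeff-++ (S x) _ c) (cong (coeff (S x) c +ℤ_) (coeff-sumP S xs c))

-- Every permutation is listed exactly once

insertAll-↭ : ∀ x ys {zs} → zs ∈ insertAll x ys → zs ↭ x ∷ ys
insertAll-↭ x []       (here refl) = ↭-refl
insertAll-↭ x (y ∷ ys) (here refl) = ↭-refl
insertAll-↭ x (y ∷ ys) (there zs∈) with ∈-map⁻ (y ∷_) zs∈
... | zs , p , refl = ↭-trans (↭-prep y (insertAll-↭ x ys p)) (↭-swap y x ↭-refl)

permsOf-↭ : ∀ xs {ys} → ys ∈ permsOf xs → ys ↭ xs
permsOf-↭ []       (here refl) = ↭-refl
permsOf-↭ (x ∷ xs) ys∈ with find (∈-concatMap⁻ (insertAll x) {xs = permsOf xs} ys∈)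
... | zs , zs∈ , p = ↭-trans (insertAll-↭ x zs p) (↭-prep x (permsOf-↭ xs zs∈))

when-≢ : ∀ x y (b : Bool) z → x ≢ y → when ((x ≡ᵇ y) ∧ b) z ≡ 0ℤ
when-≢ x y b z x≢y rewrite ≡ᵇ-false x≢y = refl

-- As `x` is missing from `as` and from `ys`, its first occurrence singles out the one insertion
-- that can match, and this one matches exactly when `ys` is `as ++ bs`.
∑-insertAll : ∀ z {x} as bs ys → x ∉ as → x ∉ ys →
              ∑ (λ zs → when (eqL (as ++ x ∷ bs) zs) z) (insertAll x ys) ≡ when (eqL (as ++ bs) ys) z
∑-insertAll z {x} []       []       []       _ _ rewrite ≡ᵇ-true {x} refl = ℤ.+-identityʳ z
∑-insertAll z {x} []       (b ∷ bs) []       _ _ rewrite ≡ᵇ-true {x} refl = refl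
∑-insertAll z {x} (a ∷ as) bs       []       x∉ _ rewrite ≡ᵇ-false {a} {x} (λ { refl → x∉ (here refl) }) = refl
∑-insertAll z {x} []       bs       (y ∷ ys) _ x∉ rewrite ≡ᵇ-true {x} refl = trans
  (cong (when (eqL bs (y ∷ ys)) z +ℤ_) (trans (∑-map (λ zs → when (eqL (x ∷ bs) zs) z) (y ∷_) (insertAll x ys))
    (trans (∑-cong (insertAll x ys) λ {zs} _ → when-≢ x y (eqL bs zs) z (λ { refl → x∉ (here refl) })) (∑-zero (insertAll x ys)))))
  (ℤ.+-identityʳ _)
∑-insertAll z {x} (a ∷ as) bs       (y ∷ ys) x∉as x∉ys = trans
  (cong₂ _+ℤ_ (when-≢ a x (eqL (as ++ x ∷ bs) (y ∷ ys)) z (λ { refl → x∉as (here refl) }))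
    (trans (∑-map (λ zs → when (eqL (a ∷ as ++ x ∷ bs) zs) z) (y ∷_) (insertAll x ys)) tail))
  (ℤ.+-identityˡ _)
  where
  tail : ∑ (λ zs → when (eqL (a ∷ as ++ x ∷ bs) (y ∷ zs)) z) (insertAll x ys) ≡ when (eqL (a ∷ as ++ bs) (y ∷ ys)) z
  tail with a ≡ᵇ y
  ... | true  = ∑-insertAll z as bs ys (x∉as ∘ there) (x∉ys ∘ there)
  ... | false = ∑-zero (insertAll x ys)

-- Expresses that `τ` occurs exactly once in the list, in the summed form needed for double
-- counting. Deleting the first letter of `xs` from `τ` gives the only permutation of the rest from
-- which `τ` can arise.
∑-permsOf : ∀ z {xs τ} → Unique xs → τ ↭ xs → ∑ (λ ys → when (eqL τ ys) z) (permsOf xs) ≡ z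
∑-permsOf z {[]} {[]}    _ p = ℤ.+-identityʳ z
∑-permsOf z {[]} {_ ∷ _} _ p = contradiction (↭-length p) λ ()
∑-permsOf z {x ∷ xs} u p with ∈-∃++ (∈-resp-↭ (↭-sym p) (here refl))
... | as , bs , refl = begin
  ∑ (λ ys → when (eqL (as ++ x ∷ bs) ys) z) (concatMap (insertAll x) (permsOf xs))
    ≡⟨ ∑-concatMap (λ ys → when (eqL (as ++ x ∷ bs) ys) z) (insertAll x) (permsOf xs) ⟩
  ∑ (λ ys → ∑ (λ zs → when (eqL (as ++ x ∷ bs) zs) z) (insertAll x ys)) (permsOf xs)
    ≡⟨ ∑-cong (permsOf xs) (λ {ys} ys∈ → ∑-insertAll z as bs ys
         (λ x∈ → proj₂ (proj₂ (Unique-++⁻ as (Unique-resp-↭ (↭-sym p) u))) x∈ (here refl))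
         (Unique⇒∉ u ∘ ∈-resp-↭ (permsOf-↭ xs ys∈))) ⟩
  ∑ (λ ys → when (eqL (as ++ bs) ys) z) (permsOf xs)
    ≡⟨ ∑-permsOf z (Unique-tail u) (drop-mid as [] p) ⟩
  z ∎
  where open ≡-Reasoning

theorem3p7 : (n : ℕ) (μ ν π : List ℕ) →
    Composition n μ → Composition n ν → Refines ν μ →
    IsPerm n π → T (isMuInv μ π) →
    invSchub n μ π ≈P
    sumP (map (invSchub n ν)
    (filterᵇ (λ τ → isMuInv ν τ ∧ Asubset n ν τ μ π) (perms n)))
theorem3p7 n μ ν π (μ>0 , |μ|) (ν>0 , |ν|) refines _ _ c = begin
  coeff (invSchub n μ π) c
    ≡⟨ coeff-invSchub μ π ⟩
  ∑ (λ w → when (inA n μ π w) (g w)) (perms n)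
    ≡⟨ ∑-cong (perms n) (sym ∘ fibre) ⟩
  ∑ (λ w → ∑ (λ τ → when (below τ ∧ inA n ν τ w) (g w)) (perms n)) (perms n)
    ≡⟨ ∑-swap (λ w τ → when (below τ ∧ inA n ν τ w) (g w)) (perms n) (perms n) ⟩
  ∑ (λ τ → ∑ (λ w → when (below τ ∧ inA n ν τ w) (g w)) (perms n)) (perms n)
    ≡⟨ ∑-cong (perms n) (λ {τ} _ → sym (trans (cong (when (below τ)) (coeff-invSchub ν τ))
         (trans (when-∑ (below τ) _ (perms n)) (∑-cong (perms n) λ {w} _ → when-∧ (below τ) (inA n ν τ w) (g w))))) ⟩
  ∑ (λ τ → when (below τ) (coeff (invSchub n ν τ) c)) (perms n)
    ≡⟨ sym (∑-filter below _ (perms n)) ⟩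
  ∑ (λ τ → coeff (invSchub n ν τ) c) (filterᵇ below (perms n))
    ≡⟨ sym (coeff-sumP (invSchub n ν) (filterᵇ below (perms n)) c) ⟩
  coeff (sumP (map (invSchub n ν) (filterᵇ below (perms n)))) c ∎
  where
  open ≡-Reasoning

  below : List ℕ → Bool
  below τ = isMuInv ν τ ∧ Asubset n ν τ μ π

  g : List ℕ → ℤ
  g w = coeff (schub n w) c

  C : Coarsening ν μ
  C = refines⇒coarsening 0 ν>0 μ>0 (trans |ν| (sym |μ|)) λ {s} s∈ →
    subst (s ∈_) (partialSums≡psums ν) (refines s (subst (s ∈_) (sym (partialSums≡psums μ)) s∈))

  open Refinement |ν| |μ| C

  coeff-invSchub : ∀ λs ρ → coeff (invSchub n λs ρ) c ≡ ∑ (λ w → when (inA n λs ρ w) (g w)) (perms n)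
  coeff-invSchub λs ρ = trans (coeff-sumP (schub n) (Aset n λs ρ) c) (∑-filter (inA n λs ρ) g (perms n))

  length-perm : ∀ {w} → w ∈ perms n → length w ≡ n
  length-perm w∈ = trans (↭-length (permsOf-↭ (oneToN n) w∈)) (length-oneToN n)

  below⁻ : ∀ {τ w} → w ∈ perms n → T (below τ ∧ inA n ν τ w) → T (inA n ν τ w) × T (inA n μ π w)
  below⁻ {τ} {w} w∈ t with Equivalence.to (T-∧ {below τ}) t
  ... | b , A = A , implied (Equivalence.to T-∨ (All.lookup (All.all⁺ (λ w → not (inA n ν τ w) ∨ inA n μ π w) (perms n)
                  (proj₂ (Equivalence.to (T-∧ {isMuInv ν τ}) b))) w∈))
    where
    implied : T (not (inA n ν τ w)) ⊎ T (inA n μ π w) → T (inA n μ π w)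
    implied (inj₁ ¬A) = contradiction A (subst T (Equivalence.to T-not-≡ ¬A))
    implied (inj₂ A′) = A′

  below⁺ : ∀ {w} → w ∈ perms n → T (inA n μ π w) → T (below (eAct n ν w) ∧ inA n ν (eAct n ν w) w)
  below⁺ {w} w∈ A = Equivalence.from T-∧ (Equivalence.from T-∧
    ( All.all⁻ (λ B → isInvolution (std B)) (proj₂ (valid w∈))
    , All.all⁻ (λ w′ → not (inA n ν τ w′) ∨ inA n μ π w′) (All.tabulate λ {w′} w′∈ → sub w′∈))
    , inA⁺ {n} {ν} {τ} {w} (inA-refine {π} {w} (length-perm w∈) (inA⁻ {n} {μ} {π} {w} A)))
    where
    τ : List ℕ
    τ = eAct n ν w
    valid : ∀ {w} → w ∈ perms n → eAct n ν w ↭ oneToN n × InvolutiveBlocks (blocks ν (eAct n ν w))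
    valid {w} w∈ = actWord-valid |ν| (letters {w} (length-perm w∈)) ↭-refl (involutive-oneToN |ν|)
    sub : ∀ {w′} → w′ ∈ perms n → T (not (inA n ν τ w′) ∨ inA n μ π w′)
    sub {w′} w′∈ with inA n ν τ w′ in eq
    ... | false = _
    ... | true  = inA⁺ {n} {μ} {π} {w′} (inA-coarsen {π} {w} {w′} (length-perm w∈) (length-perm w′∈)
      (inA⁻ {n} {μ} {π} {w} A) (inA⁻ {n} {ν} {τ} {w′} (≡true⇒T eq)))

  -- The permutation `w` can lie in 𝒜_ν(τ) only for τ = e ∘_ν w. That τ is below `π` when `w` is in
  -- 𝒜_μ(π); otherwise no τ below `π` has `w` in its set.
  fibre : ∀ {w} → w ∈ perms n → ∑ (λ τ → when (below τ ∧ inA n ν τ w) (g w)) (perms n) ≡ when (inA n μ π w) (g w)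
  fibre {w} w∈ with inA n μ π w in eq
  ... | false = trans (∑-cong (perms n) λ {τ} _ → if-false (¬T⇒≡false λ t → subst T eq (proj₂ (below⁻ {τ} w∈ t))))
                      (∑-zero (perms n))
  ... | true  = trans (∑-cong (perms n) λ {τ} _ → cong (λ b → when b (g w)) (only τ))
                      (∑-permsOf (g w) (oneToN-unique n) (proj₁ (actWord-valid {ν = ν} |ν| (letters {w} (length-perm w∈)) ↭-refl (involutive-oneToN |ν|))))
    where
    only : ∀ τ → below τ ∧ inA n ν τ w ≡ eqL (eAct n ν w) τ
    only τ = T-iff⇒≡
      (λ t → proj₁ (Equivalence.to T-∧ (proj₁ (below⁻ {τ} w∈ t))))
      (λ t → subst (λ τ → T (below τ ∧ inA n ν τ w)) (eqL⇒≡ (eAct n ν w) τ t) (below⁺ w∈ (≡true⇒T eq)))
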